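{- The problem \textsc{Short Path with Lower and Upper Bounds}, restricted to instances with $\ell = \operatorname{dist}(s,t)$ (the length of a shortest $s$-$t$-path in $G$), can be solved in $\mathcal{O}(n^{c}\cdot m)$ time, where $n=|V|$, $m=|A|$, and $c$ is the number of colors.
   Context: \textsc{Short Path with Lower and Upper Bounds}: Input: a directed graph $G=(V,A)$, a vertex coloring $\chi\colon V\to\{1,\dots,c\}$, an arc-length function $w\colon A\to\mathbb{N}$ (positive integers), two vertices $s,t\in V$, and integers $\ell,\alpha_1,\dots,\alpha_c,\beta_1,\dots,\beta_c$. Question: is there a path $P$ from $s$ to $t$ in $G$ of total arc length at most $\ell$ such that for each $i\in\{1,\dots,c\}$ the number of vertices of $P$ (including $s$ and $t$) with color $i$ is at least $\alpha_i$ and at most $\beta_i$? -}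

module Defs where

open import Data.Bool.Base using (Bool; if_then_else_)
open import Data.Fin.Base using (Fin; toℕ)
import Data.Fin.Properties as Fin
open import Data.Integer.Base using (ℤ; +_; -[1+_]; +[1+_]; 0ℤ)
import Data.Integer.Base as ℤ
open import Data.List.Base using (List; []; _∷_; _++_; [_]; length; filter; tabulate; concat)
open import Data.List.Relation.Unary.Unique.Propositional using (Unique)
open import Data.Maybe.Base using (Maybe; just; nothing; fromMaybe)
open import Data.Nat.Base using (ℕ; zero; suc; _+_; _*_; _≤_; _<_; _≡ᵇ_)
open import Data.Product.Base using (_×_; _,_; ∃-syntax; proj₁; proj₂)
open import Function.Definitions using (Injective)
open import Relation.Binary.Construct.Closure.ReflexiveTransitive using (Star; ε; _◅_)
open import Relation.Binary.PropositionalEquality.Core using (_≡_)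
open import Relation.Nullary.Reflects using (Reflects)

-- A directed graph with vertex set Fin n whose arc set is a set of m ordered
-- pairs, enumerated without repetition.  Loops are allowed.
record Digraph (n m : ℕ) : Set where
  field
    arc          : Fin m → Fin n × Fin n
    arc-distinct : Injective _≡_ _≡_ arc

record Instance : Set where
  field
    n m c  : ℕ
    graph  : Digraph n m
    χ      : Fin n → Fin c
    w      : Fin m → ℕ
    w-pos  : ∀ a → 0 < w a
    s t    : Fin n
    ℓ      : ℤ
    α β    : Fin c → ℤ

  open Digraph graph public

  Arc : Fin n → Fin n → Set
  Arc u v = ∃[ a ] arc a ≡ (u , v)

  Walk : Fin n → Fin n → Set
  Walk = Star Arc

  vertices : ∀ {u v} → Walk u v → List (Fin n)
  vertices {u} ε       = [ u ]
  vertices {u} (_ ◅ P) = u ∷ vertices P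

  arcLength : ∀ {u v} → Walk u v → ℕ
  arcLength ε             = 0
  arcLength ((a , _) ◅ P) = w a + arcLength P

  IsPath : ∀ {u v} → Walk u v → Set
  IsPath P = Unique (vertices P)

  colorCount : ∀ {u v} → Fin c → Walk u v → ℕ
  colorCount i P = length (filter (λ v → χ v Fin.≟ i) (vertices P))

  IsYes : Set
  IsYes = ∃[ P ] IsPath {s} {t} P
        × + arcLength P ℤ.≤ ℓ
        × (∀ i → α i ℤ.≤ + colorCount i P × + colorCount i P ℤ.≤ β i)

  -- In particular t is reachable from s when ℓ is the distance.
  IsDist : Fin n → Fin n → ℤ → Set
  IsDist u v d = (∃[ P ] IsPath {u} {v} P × + arcLength P ≡ d)
               × (∀ (P : Walk u v) → IsPath P → d ℤ.≤ + arcLength P)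

  -- n, m, c, s, t, ℓ; the color of each vertex; tail, head and length of each
  -- arc; all lower bounds; all upper bounds.  Vertices and colors are numbered
  -- from 0.
  encode : List ℤ
  encode = (+ n ∷ + m ∷ + c ∷ + toℕ s ∷ + toℕ t ∷ ℓ ∷ [])
        ++ tabulate (λ v → + toℕ (χ v))
        ++ concat (tabulate λ a → + toℕ (proj₁ (arc a)) ∷ + toℕ (proj₂ (arc a)) ∷ + w a ∷ [])
        ++ tabulate α
        ++ tabulate β

-- A random access machine over ℤ with the uniform cost measure.  As in the
-- model of Cook and Reckhow, addition and subtraction are the only arithmetic:
-- with unit-cost multiplication, time bounds would not be meaningful.
-- Registers are named statically by the program; only the memory is addressed
-- indirectly.

Reg Label : Set
Reg   = ℕ
Label = ℕ

data Instr : Set where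
  set        : Reg → ℤ → Instr
  add sub    : (dst x y : Reg) → Instr
  load       : (dst addr : Reg) → Instr
  store      : (addr src : Reg) → Instr
  jump       : Label → Instr
  jumpPos    : Reg → Label → Instr
  answer     : Bool → Instr

Program : Set
Program = List Instr

record State : Set where
  constructor ⟨_,_,_⟩
  field
    pc  : Label
    reg : Reg → ℤ
    mem : ℕ → ℤ

infixl 6 _[_≔_]

_[_≔_] : {A : Set} → (ℕ → A) → ℕ → A → (ℕ → A)
(f [ i ≔ x ]) j = if i ≡ᵇ j then x else f j

_‼_ : {A : Set} → List A → ℕ → Maybe A
[]       ‼ _     = nothing
(x ∷ _)  ‼ zero  = just x
(_ ∷ xs) ‼ suc i = xs ‼ i

data Outcome : Set where
  continue : State → Outcome
  halt     : Bool → Outcome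
  crash    : Outcome

execute : Instr → State → Outcome
execute (set d k)     ⟨ pc , r , M ⟩ = continue ⟨ suc pc , r [ d ≔ k ] , M ⟩
execute (add d x y)   ⟨ pc , r , M ⟩ = continue ⟨ suc pc , r [ d ≔ r x ℤ.+ r y ] , M ⟩
execute (sub d x y)   ⟨ pc , r , M ⟩ = continue ⟨ suc pc , r [ d ≔ r x ℤ.- r y ] , M ⟩
execute (load d a)    ⟨ pc , r , M ⟩ with r a
... | + i      = continue ⟨ suc pc , r [ d ≔ M i ] , M ⟩
... | -[1+ _ ] = crash
execute (store a x)   ⟨ pc , r , M ⟩ with r a
... | + i      = continue ⟨ suc pc , r , M [ i ≔ r x ] ⟩
... | -[1+ _ ] = crash
execute (jump l)      ⟨ _  , r , M ⟩ = continue ⟨ l , r , M ⟩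
execute (jumpPos x l) ⟨ pc , r , M ⟩ with r x
... | +[1+ _ ] = continue ⟨ l , r , M ⟩
... | _        = continue ⟨ suc pc , r , M ⟩
execute (answer b)    _              = halt b

step : Program → State → Outcome
step p σ with p ‼ State.pc σ
... | just i  = execute i σ
... | nothing = crash

-- The input occupies the first memory cells; everything else is 0.
initial : List ℤ → State
initial xs = ⟨ 0 , (λ _ → 0ℤ) , (λ i → fromMaybe 0ℤ (xs ‼ i)) ⟩

infix 4 _⊢_⇓⟨_⟩_

-- p ⊢ σ ⇓⟨ k ⟩ b : started in σ, p answers b after executing exactly k instructions.
data _⊢_⇓⟨_⟩_ (p : Program) : State → ℕ → Bool → Set where
  stop : ∀ {σ b} → step p σ ≡ halt b → p ⊢ σ ⇓⟨ 1 ⟩ b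
  next : ∀ {σ σ′ k b} → step p σ ≡ continue σ′ → p ⊢ σ′ ⇓⟨ k ⟩ b → p ⊢ σ ⇓⟨ suc k ⟩ b

-- The restriction of a decision problem to a promise is solved in O(f) time:
-- one program and one constant serve all instances.  The program must answer
-- correctly on every promised instance; Large marks those on which the
-- asymptotic bound is required to hold.
SolvableInTimeO : {I : Set} (enc : I → List ℤ) (Yes Promise Large : I → Set)
                  (f : I → ℕ) → Set
SolvableInTimeO {I} enc Yes Promise Large f =
  ∃[ p ] ∃[ K ] ∀ (x : I) → Promise x →
    ∃[ b ] ∃[ k ] p ⊢ initial (enc x) ⇓⟨ k ⟩ b
                × Reflects (Yes x) b
                × (Large x → k ≤ K * f x)

ℓ-is-distance : Instance → Set
ℓ-is-distance x = IsDist s t ℓ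
  where open Instance x

-- A loopless graph with an arc has two vertices, so 2 ≤ n only excludes a
-- single vertex with a loop.  There, and for m = 0, the expression n ^ c * m is
-- at most 1 whatever c is, although every color bound has to be read.
NonDegenerate : Instance → Set
NonDegenerate x = 2 ≤ n × 1 ≤ m
  where open Instance x

{-
Index a walk ending in t by the sum, over its vertices v, of S (χ v), where S i is
the product of (size j + 1) over the colors j < i and size j is the number of
vertices of color j.  A path has at most size j vertices of color j, so its index
is less than S c and encodes its color counts as mixed-radix digits.  For
every index k and vertex u, compute the length of a shortest walk from u to t of
index k.  Prepending an arc increases the index, so handling the indices in
increasing order and relaxing all arcs for each of them suffices.  A walk that
is not a path may share its index with a path, but this does no harm: a walk from s
to t of length at most ℓ = dist (s, t) is a path.  So it remains to decode, for every
index k with an s-t-walk of length at most ℓ, the digits of k by repeated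
subtraction, and to compare them with the bounds.  The digits add up to the number
of vertices of a path, hence to at most m + 1, so the time is
O (S c * (m + c) + c * n), and c * S c is O (n ^ c).
-}
module Submission where

open import Defs hiding (set; add; sub; load; store)
open import Data.Bool.Base using (true; false; if_then_else_)
open import Data.Fin using (#_)
open import Data.Fin.Base using (Fin; zero; suc; toℕ; fromℕ<)
open import Data.Fin.Properties using (toℕ<n; toℕ-fromℕ<; toℕ-injective)
import Data.Fin.Properties as Fin
open import Data.Integer.Base using (ℤ; +_; -[1+_]; +[1+_]; 0ℤ)
import Data.Integer.Base as ℤ
import Data.Integer.Properties as ℤ
open import Data.List.Base
  using (List; []; _∷_; _++_; [_]; length; filter; map; tabulate; concat; downFrom)
import Data.List.Base as List
open import Data.List.Membership.Propositional using (_∈_)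
open import Data.List.Membership.Propositional.Properties
  using (∈-filter⁺; ∈-filter⁻; ∈-lookup; ∈-map⁻; ∈-downFrom⁺; ∈-downFrom⁻; ∈-allFin)
open import Data.List.Properties
  using (length-++; length-map; length-tabulate; length-downFrom; map-∘; map-cong; filter-≐)
open import Data.List.Relation.Binary.Subset.Propositional using (_⊆_)
open import Data.List.Relation.Unary.All as All using (All; []; _∷_)
import Data.List.Relation.Unary.All.Properties as All
open import Data.List.Relation.Unary.AllPairs.Core using ([]; _∷_)
open import Data.List.Relation.Unary.Any as Any using (here; there)
import Data.List.Relation.Unary.Any.Properties as Any
open import Data.List.Relation.Unary.Unique.Propositional using (Unique)
import Data.List.Relation.Unary.Unique.Propositional.Properties as Unique
open import Data.Maybe.Base using (just; nothing; fromMaybe)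
open import Data.Nat.Base hiding (∣_-_∣)
open import Data.Nat.ListAction using (sum)
open import Data.Nat.Properties
open import Data.Nat.Tactic.RingSolver using (solve-∀)
open import Data.Product.Base using (_×_; _,_; ∃-syntax; proj₁; proj₂)
open import Data.Sum.Base using (_⊎_; inj₁; inj₂)
open import Data.Unit.Base using (⊤; tt)
open import Data.Vec.Base using (Vec; []; _∷_; lookup; replicate) renaming (_[_]≔_ to _⟦_⟧≔_)
open import Data.Vec.Properties using (lookup∘update; lookup∘update′; lookup-replicate)
open import Function.Base using (_∘_; const)
open import Relation.Binary.Construct.Closure.ReflexiveTransitive using (ε; _◅_)
open import Relation.Binary.Definitions using (tri<; tri≈; tri>)
open import Relation.Binary.PropositionalEquality hiding ([_])
open import Relation.Nullary.Decidable.Core using (yes; no)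
open import Relation.Nullary.Negation.Core using (¬_; contradiction)
open import Relation.Nullary.Reflects using (Reflects; ofʸ; ofⁿ)

-- Updates of functions, and finite runs of the machine.

Fin⇒0< : ∀ {n} → Fin n → 0 < n
Fin⇒0< i = ≤-trans (s≤s z≤n) (toℕ<n i)

≡ᵇ-refl : ∀ i → (i ≡ᵇ i) ≡ true
≡ᵇ-refl zero    = refl
≡ᵇ-refl (suc i) = ≡ᵇ-refl i

≢⇒≡ᵇ-false : ∀ {i j} → i ≢ j → (i ≡ᵇ j) ≡ false
≢⇒≡ᵇ-false {zero}  {zero}  i≢j with () ← i≢j refl
≢⇒≡ᵇ-false {zero}  {suc j} _   = refl
≢⇒≡ᵇ-false {suc i} {zero}  _   = refl
≢⇒≡ᵇ-false {suc i} {suc j} i≢j = ≢⇒≡ᵇ-false (i≢j ∘ cong suc)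

module _ {A : Set} (f : ℕ → A) (i : ℕ) (x : A) where

  update-same : (f Defs.[ i ≔ x ]) i ≡ x
  update-same rewrite ≡ᵇ-refl i = refl

  update-other : ∀ {j} → i ≢ j → (f Defs.[ i ≔ x ]) j ≡ f j
  update-other i≢j rewrite ≢⇒≡ᵇ-false i≢j = refl

infix 4 _⊢_⟶⟨_⟩_

-- Unlike `_⊢_⇓⟨_⟩_`, such a run need not end in an answer, so that runs of successive fragments
-- compose.
data _⊢_⟶⟨_⟩_ (p : Program) : State → ℕ → State → Set where
  done : ∀ {σ} → p ⊢ σ ⟶⟨ 0 ⟩ σ
  _then_ : ∀ {σ σ′ σ″ k} → step p σ ≡ continue σ′ → p ⊢ σ′ ⟶⟨ k ⟩ σ″ → p ⊢ σ ⟶⟨ suc k ⟩ σ″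

infixr 5 _then_

⟶-trans : ∀ {p σ σ′ σ″ k k′} → p ⊢ σ ⟶⟨ k ⟩ σ′ → p ⊢ σ′ ⟶⟨ k′ ⟩ σ″ → p ⊢ σ ⟶⟨ k + k′ ⟩ σ″
⟶-trans done       ys = ys
⟶-trans (x then xs) ys = x then ⟶-trans xs ys

⟶-⇓ : ∀ {p σ σ′ k k′ b} → p ⊢ σ ⟶⟨ k ⟩ σ′ → p ⊢ σ′ ⇓⟨ k′ ⟩ b → p ⊢ σ ⇓⟨ k + k′ ⟩ b
⟶-⇓ done       ys = ys
⟶-⇓ (x then xs) ys = next x (⟶-⇓ xs ys)

-- Structured programs

data Op (R : ℕ) : Set where
  set     : Fin R → ℤ → Op R
  add sub : (dst x y : Fin R) → Op R
  load    : (dst addr : Fin R) → Op R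
  store   : (addr src : Fin R) → Op R

infixr 4 _⨾_

-- The only conditional jump tests for positivity. Hence a positive register makes `unless` skip its
-- body and `while` repeat it.
data Cmd (R : ℕ) : Set where
  block  : List (Op R) → Cmd R
  _⨾_    : Cmd R → Cmd R → Cmd R
  unless : Fin R → Cmd R → Cmd R
  while  : Fin R → Cmd R → Cmd R

module _ {R : ℕ} where

  instr : Op R → Instr
  instr (set d z)   = Instr.set (toℕ d) z
  instr (add d x y) = Instr.add (toℕ d) (toℕ x) (toℕ y)
  instr (sub d x y) = Instr.sub (toℕ d) (toℕ x) (toℕ y)
  instr (load d a)  = Instr.load (toℕ d) (toℕ a)
  instr (store a x) = Instr.store (toℕ a) (toℕ x)

  ∣_∣ : Cmd R → ℕ
  ∣ block is ∣   = length is
  ∣ c ⨾ d ∣      = ∣ c ∣ + ∣ d ∣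
  ∣ unless x c ∣ = suc ∣ c ∣
  ∣ while x c ∣  = 2 + (∣ c ∣ + 1)

  -- The jumps are absolute, so the code depends on the address o of its first
  -- instruction.
  compile : Cmd R → ℕ → List Instr
  compile (block is)   o = map instr is
  compile (c ⨾ d)      o = compile c o ++ compile d (o + ∣ c ∣)
  compile (unless x c) o = jumpPos (toℕ x) (suc o + ∣ c ∣) ∷ compile c (suc o)
  compile (while x c)  o = jumpPos (toℕ x) (2 + o) ∷ jump (3 + o + ∣ c ∣)
                         ∷ compile c (2 + o) ++ [ jump o ]

  length-compile : ∀ c o → length (compile c o) ≡ ∣ c ∣
  length-compile (block is)   o = length-map instr is
  length-compile (c ⨾ d)      o = trans (length-++ (compile c o))
                                    (cong₂ _+_ (length-compile c o) (length-compile d _))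
  length-compile (unless x c) o = cong suc (length-compile c _)
  length-compile (while x c)  o = cong (_+_ 2)
    (trans (length-++ (compile c (2 + o))) (cong (_+ 1) (length-compile c (2 + o))))

CodeAt : Program → ℕ → List Instr → Set
CodeAt p o []       = ⊤
CodeAt p o (i ∷ is) = p ‼ o ≡ just i × CodeAt p (suc o) is

CodeAt-++ : ∀ {p} is {js o} → CodeAt p o (is ++ js) → CodeAt p o is × CodeAt p (o + length is) js
CodeAt-++ []           {o = o} code rewrite +-identityʳ o = tt , code
CodeAt-++ (i ∷ is) {o = o} (eq , code)
  rewrite +-suc o (length is) with CodeAt-++ is code
... | code₁ , code₂ = (eq , code₁) , code₂

CodeAt-∷ : ∀ {p i} is {o} → CodeAt p o is → CodeAt (i ∷ p) (suc o) is
CodeAt-∷ []       _           = tt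
CodeAt-∷ (_ ∷ is) (eq , code) = eq , CodeAt-∷ is code

CodeAt-self : ∀ p → CodeAt p 0 p
CodeAt-self []      = tt
CodeAt-self (i ∷ p) = refl , CodeAt-∷ p (CodeAt-self p)

-- A program logic with running times, and its soundness for compiled code.

Mem : Set
Mem = ℕ → ℤ

-- Only the finitely many registers named in the program are tracked, so that their contents can be
-- written as an explicit vector.
Env : ℕ → Set
Env R = Vec ℤ R

Assertion : ℕ → Set₁
Assertion R = Env R → Mem → Set

jump-taken : ∀ {p o r l M x z} → p ‼ o ≡ just (jumpPos x l) → r x ≡ z → 0ℤ ℤ.< z →
             step p ⟨ o , r , M ⟩ ≡ continue ⟨ l , r , M ⟩
jump-taken {z = +[1+ _ ]} eq rx _ rewrite eq | rx = refl
jump-taken {z = + 0}      eq rx (ℤ.+<+ ())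

jump-skipped : ∀ {p o r l M x z} → p ‼ o ≡ just (jumpPos x l) → r x ≡ z → z ℤ.≤ 0ℤ →
               step p ⟨ o , r , M ⟩ ≡ continue ⟨ suc o , r , M ⟩
jump-skipped {z = + 0}       eq rx _ rewrite eq | rx = refl
jump-skipped {z = -[1+ _ ]} eq rx _ rewrite eq | rx = refl
jump-skipped {z = +[1+ _ ]}  eq rx (ℤ.+≤+ ())

-- Leaving the loop costs two jumps, an iteration one jump before and one after
-- the body.
loopCost : (ℕ → ℕ) → ℕ → ℕ
loopCost k zero    = 2
loopCost k (suc j) = 2 + k j + loopCost k j

module _ {R : ℕ} where

  infix 4 _⊨_

  _⊨_ : (Reg → ℤ) → Env R → Set
  r ⊨ ρ = ∀ i → r (toℕ i) ≡ lookup ρ i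

  ⊨-update : ∀ r ρ → r ⊨ ρ → ∀ d z → r Defs.[ toℕ d ≔ z ] ⊨ ρ ⟦ d ⟧≔ z
  ⊨-update r ρ r⊨ρ d z i with d Fin.≟ i
  ... | yes refl = trans (update-same r (toℕ d) z) (sym (lookup∘update d ρ z))
  ... | no  d≢i  = trans (update-other r (toℕ d) z (d≢i ∘ toℕ-injective))
                     (trans (r⊨ρ i) (sym (lookup∘update′ (d≢i ∘ sym) ρ z)))

  Reaches : Program → State → ℕ → Label → Assertion R → Set
  Reaches p σ k l Q = ∃[ k′ ] ∃[ r ] ∃[ ρ ] ∃[ M ]
    p ⊢ σ ⟶⟨ k′ ⟩ ⟨ l , r , M ⟩ × k′ ≤ k × r ⊨ ρ × Q ρ M

  -- `k` is an upper bound, since the branches of a command differ in length. Quantifying over `p`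
  -- and `o` makes the triple independent of the position of the code.
  record Runs (c : Cmd R) (k : ℕ) (Q : Assertion R) (ρ : Env R) (M : Mem) : Set where
    field
      reaches : ∀ {p o r} → CodeAt p o (compile c o) → r ⊨ ρ →
                Reaches p ⟨ o , r , M ⟩ k (o + ∣ c ∣) Q

  open Runs

  -- The results of operations are abstracted by equations, so that the symbolic
  -- register contents stay in the form chosen in the proof.
  wp : List (Op R) → Assertion R → Assertion R
  wp []                 Q ρ M = Q ρ M
  wp (set d z ∷ is)     Q ρ M = wp is Q (ρ ⟦ d ⟧≔ z) M
  wp (add d x y ∷ is)   Q ρ M = ∃[ z ] lookup ρ x ℤ.+ lookup ρ y ≡ z × wp is Q (ρ ⟦ d ⟧≔ z) M
  wp (sub d x y ∷ is)   Q ρ M = ∃[ z ] lookup ρ x ℤ.- lookup ρ y ≡ z × wp is Q (ρ ⟦ d ⟧≔ z) M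
  wp (load d a ∷ is)    Q ρ M = ∃[ i ] ∃[ z ] lookup ρ a ≡ + i × M i ≡ z × wp is Q (ρ ⟦ d ⟧≔ z) M
  wp (store a x ∷ is)   Q ρ M = ∃[ i ] lookup ρ a ≡ + i × wp is Q ρ (M Defs.[ i ≔ lookup ρ x ])

  run-block : ∀ {is Q ρ M} → wp is Q ρ M → Runs (block is) (length is) Q ρ M
  run-block {[]} {ρ = ρ} {M} q .reaches {o = o} {r} _ r⊨ρ rewrite +-identityʳ o =
    0 , r , ρ , M , done , z≤n , r⊨ρ , q
  run-block {i ∷ is} {Q} {ρ} {M} q .reaches {p} {o} {r} (eq , code) r⊨ρ rewrite +-suc o (length is) = go i q eq
    where
    Goal = Reaches p ⟨ o , r , M ⟩ (suc (length is)) (suc (o + length is)) Q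

    continue-with : ∀ {ρ′ r′ M′} → step p ⟨ o , r , M ⟩ ≡ continue ⟨ suc o , r′ , M′ ⟩ →
      r′ ⊨ ρ′ → wp is Q ρ′ M′ → Goal
    continue-with st r′⊨ρ′ q′ with run-block {is} {Q} q′ .reaches {p} {suc o} code r′⊨ρ′
    ... | k , r″ , ρ″ , M″ , steps , k≤ , r″⊨ρ″ , q″ =
      suc k , r″ , ρ″ , M″ , st then steps , s≤s k≤ , r″⊨ρ″ , q″

    go : ∀ i → wp (i ∷ is) Q ρ M → p ‼ o ≡ just (instr i) → Goal
    go (set d z) q eq = continue-with st (⊨-update r ρ r⊨ρ d z) q
      where
      st : step p ⟨ o , r , M ⟩ ≡ continue ⟨ suc o , r Defs.[ toℕ d ≔ z ] , M ⟩
      st rewrite eq = refl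
    go (add d x y) (z , total , q) eq = continue-with st (⊨-update r ρ r⊨ρ d z) q
      where
      st : step p ⟨ o , r , M ⟩ ≡ continue ⟨ suc o , r Defs.[ toℕ d ≔ z ] , M ⟩
      st rewrite eq | r⊨ρ x | r⊨ρ y | total = refl
    go (sub d x y) (z , diff , q) eq = continue-with st (⊨-update r ρ r⊨ρ d z) q
      where
      st : step p ⟨ o , r , M ⟩ ≡ continue ⟨ suc o , r Defs.[ toℕ d ≔ z ] , M ⟩
      st rewrite eq | r⊨ρ x | r⊨ρ y | diff = refl
    go (load d a) (i , z , addr , val , q) eq = continue-with st (⊨-update r ρ r⊨ρ d z) q
      where
      st : step p ⟨ o , r , M ⟩ ≡ continue ⟨ suc o , r Defs.[ toℕ d ≔ z ] , M ⟩
      st rewrite eq | r⊨ρ a | addr | val = refl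
    go (store a x) (i , addr , q) eq = continue-with st r⊨ρ q
      where
      st : step p ⟨ o , r , M ⟩ ≡ continue ⟨ suc o , r , M Defs.[ i ≔ lookup ρ x ] ⟩
      st rewrite eq | r⊨ρ a | addr | r⊨ρ x = refl

  -- The postcondition of the first command is that the second one runs, which avoids stating
  -- intermediate assertions.
  run-seq : ∀ {c d k k′ Q ρ M} → Runs c k (Runs d k′ Q) ρ M → Runs (c ⨾ d) (k + k′) Q ρ M
  run-seq {c} {d} run .reaches {p} {o} code r⊨ρ
    with code₁ , code₂ ← CodeAt-++ (compile c o) code
    with j , r′ , ρ′ , M′ , steps , j≤ , r′⊨ρ′ , run′ ← reaches run code₁ r⊨ρ
    with j′ , r″ , ρ″ , M″ , steps′ , j′≤ , r″⊨ρ″ , q ←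
      reaches run′
        (subst (λ a → CodeAt p a (compile d (o + ∣ c ∣))) (cong (_+_ o) (length-compile c o)) code₂) r′⊨ρ′
    rewrite sym (+-assoc o ∣ c ∣ ∣ d ∣) =
      j + j′ , r″ , ρ″ , M″ , ⟶-trans steps steps′ , +-mono-≤ j≤ j′≤ , r″⊨ρ″ , q

  run-mono : ∀ {c k k′ ρ M} {Q Q′ : Assertion R} → k ≤ k′ → (∀ {ρ M} → Q ρ M → Q′ ρ M) →
             Runs c k Q ρ M → Runs c k′ Q′ ρ M
  run-mono k≤k′ Q⊆Q′ run .reaches code r⊨ρ with reaches run code r⊨ρ
  ... | j , r′ , ρ′ , M′ , steps , j≤ , r′⊨ρ′ , q =
    j , r′ , ρ′ , M′ , steps , ≤-trans j≤ k≤k′ , r′⊨ρ′ , Q⊆Q′ q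

  run-unless : ∀ {x c k Q ρ M} → (lookup ρ x ℤ.≤ 0ℤ → Runs c k Q ρ M) →
               (0ℤ ℤ.< lookup ρ x → Q ρ M) → Runs (unless x c) (suc k) Q ρ M
  run-unless {x} {c} {ρ = ρ} {M} run q .reaches {p} {o} {r} (eq , code) r⊨ρ
    with lookup ρ x ℤ.≤? 0ℤ
  ... | no  x≰0 = 1 , r , ρ , M ,
      subst (λ a → p ⊢ ⟨ o , r , M ⟩ ⟶⟨ 1 ⟩ ⟨ a , r , M ⟩) (sym (+-suc o ∣ c ∣))
        (jump-taken {p} eq (r⊨ρ x) 0<x then done) ,
      s≤s z≤n , r⊨ρ , q 0<x
    where 0<x = ℤ.≰⇒> x≰0
  ... | yes x≤0 with reaches (run x≤0) code r⊨ρ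
  ... | j , r′ , ρ′ , M′ , steps , j≤ , rest rewrite +-suc o ∣ c ∣ =
      suc j , r′ , ρ′ , M′ , jump-skipped {p} eq (r⊨ρ x) x≤0 then steps , s≤s j≤ , rest

  -- Inv j is the invariant when j iterations remain.
  run-while : ∀ {x c} {k : ℕ → ℕ} (Inv : ℕ → Assertion R) →
    (∀ {ρ M} → Inv 0 ρ M → lookup ρ x ℤ.≤ 0ℤ) →
    (∀ {j ρ M} → Inv (suc j) ρ M → 0ℤ ℤ.< lookup ρ x × Runs c (k j) (Inv j) ρ M) →
    ∀ j {ρ M} → Inv j ρ M → Runs (while x c) (loopCost k j) (Inv 0) ρ M
  run-while {x} {c} Inv exit body zero {ρ} {M} inv .reaches {p} {o} {r} (eq₁ , eq₂ , code) r⊨ρ =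
    2 , r , ρ , M ,
    subst (λ a → p ⊢ ⟨ o , r , M ⟩ ⟶⟨ 2 ⟩ ⟨ a , r , M ⟩) end
      (jump-skipped {p} eq₁ (r⊨ρ x) (exit inv) then jumped then done) ,
    ≤-refl , r⊨ρ , inv
    where
    jumped : step p ⟨ suc o , r , M ⟩ ≡ continue ⟨ 3 + o + ∣ c ∣ , r , M ⟩
    jumped rewrite eq₂ = refl
    end : 3 + o + ∣ c ∣ ≡ o + (2 + (∣ c ∣ + 1))
    end = trans (cong (λ a → 2 + a) (trans (sym (+-suc o ∣ c ∣)) (cong (_+_ o) (+-comm 1 ∣ c ∣))))
            (sym (trans (+-suc o _) (cong suc (+-suc o _))))
  run-while {x} {c} {k} Inv exit body (suc j) {ρ} {M} inv .reaches {p} {o} {r} code@(eq₁ , eq₂ , code′) r⊨ρ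
    with 0<x , run ← body inv
    with code₁ , eq₃ , _ ← CodeAt-++ (compile c (2 + o)) code′
    with i , r′ , ρ′ , M′ , steps , i≤ , r′⊨ρ′ , inv′ ← reaches run code₁ r⊨ρ
    with i′ , r″ , ρ″ , M″ , steps′ , i′≤ , rest ←
      run-while {x} {c} {k} Inv exit body j inv′ .reaches {p} {o} code r′⊨ρ′ =
      suc (i + suc i′) , r″ , ρ″ , M″ ,
      jump-taken {p} eq₁ (r⊨ρ x) 0<x then ⟶-trans steps (back then steps′) ,
      s≤s (≤-trans (+-mono-≤ i≤ (s≤s i′≤)) (≤-reflexive (+-suc (k j) _))) , rest
    where
    back : step p ⟨ 2 + o + ∣ c ∣ , r′ , M′ ⟩ ≡ continue ⟨ o , r′ , M′ ⟩
    back rewrite trans (cong (p ‼_) (cong (_+_ (2 + o)) (sym (length-compile c (2 + o))))) eq₃ = refl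

  verdict : Cmd R → Fin R → Program
  verdict c x = jumpPos (toℕ x) (2 + ∣ c ∣) ∷ answer false ∷ answer true ∷ []

  decider : Cmd R → Fin R → Program
  decider c x = compile c 0 ++ verdict c x

  decider-halts : ∀ {c x k Q M} → Runs c k Q (replicate R 0ℤ) M →
    ∃[ b ] ∃[ k′ ] ∃[ ρ ] ∃[ M′ ] decider c x ⊢ ⟨ 0 , const 0ℤ , M ⟩ ⇓⟨ k′ ⟩ b
      × k′ ≤ k + 2 × Q ρ M′ × Reflects (0ℤ ℤ.< lookup ρ x) b
  decider-halts {c} {x} {k} {M = M} run
    with code , code′ ← CodeAt-++ (compile c 0) (CodeAt-self (decider c x))
    with eq₁ , eq₂ , eq₃ , _ ← subst (λ l → CodeAt (decider c x) l (verdict c x)) (length-compile c 0) code′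
    with k′ , r , ρ , M′ , steps , k′≤k , r⊨ρ , q ← run .reaches code (λ i → sym (lookup-replicate i 0ℤ))
    with 0ℤ ℤ.<? lookup ρ x
  ... | yes 0<x = true , k′ + 2 , ρ , M′ ,
    ⟶-⇓ steps (next (jump-taken {decider c x} eq₁ (r⊨ρ x) 0<x) (stop halts)) , +-monoˡ-≤ 2 k′≤k , q , ofʸ 0<x
    where
    halts : Defs.step (decider c x) ⟨ 2 + ∣ c ∣ , r , M′ ⟩ ≡ halt true
    halts rewrite eq₃ = refl
  ... | no  0≮x = false , k′ + 2 , ρ , M′ ,
    ⟶-⇓ steps (next (jump-skipped {decider c x} eq₁ (r⊨ρ x) (ℤ.≮⇒≥ 0≮x)) (stop halts)) ,
    +-monoˡ-≤ 2 k′≤k , q , ofⁿ 0≮x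
    where
    halts : Defs.step (decider c x) ⟨ 1 + ∣ c ∣ , r , M′ ⟩ ≡ halt false
    halts rewrite eq₂ = refl

-- Counting and mixed radix

-- The Kronecker delta, on the boolean test underlying `≟`: one case split reduces both it and
-- `filter`.
δ : ℕ → ℕ → ℕ
δ x i = if x ≡ᵇ i then 1 else 0

δ-same : ∀ i → δ i i ≡ 1
δ-same i rewrite ≡ᵇ-refl i = refl

δ-other : ∀ {x i} → x ≢ i → δ x i ≡ 0
δ-other x≢i rewrite ≢⇒≡ᵇ-false x≢i = refl

count : ℕ → List ℕ → ℕ
count i []       = 0
count i (x ∷ xs) = δ x i + count i xs

-- Constant weights give the number of vertices, strides give the index; one exchange of summation
-- then serves for both.
weigh : (weight f : ℕ → ℕ) → ℕ → ℕ
weigh s f zero    = 0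
weigh s f (suc i) = weigh s f i + f i * s i

module _ (s : ℕ → ℕ) where

  weigh-+ : ∀ f g i → weigh s (λ j → f j + g j) i ≡ weigh s f i + weigh s g i
  weigh-+ f g zero    = refl
  weigh-+ f g (suc i) = trans (cong (_+ (f i + g i) * s i) (weigh-+ f g i))
    (rearrange (weigh s f i) (weigh s g i) (f i) (g i) (s i))
    where
    rearrange : ∀ a b x y z → a + b + (x + y) * z ≡ a + x * z + (b + y * z)
    rearrange = solve-∀

  weigh-0 : ∀ i → weigh s (const 0) i ≡ 0
  weigh-0 zero    = refl
  weigh-0 (suc i) = trans (+-identityʳ _) (weigh-0 i)

  weigh-δ-≥ : ∀ {x} i → i ≤ x → weigh s (δ x) i ≡ 0
  weigh-δ-≥ zero    _   = refl
  weigh-δ-≥ (suc i) i<x rewrite δ-other (>⇒≢ i<x) = trans (+-identityʳ _) (weigh-δ-≥ i (<⇒≤ i<x))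

  weigh-δ-< : ∀ {x} i → x < i → weigh s (δ x) i ≡ s x
  weigh-δ-< {x} (suc i) (s≤s x≤i) with x ≟ i
  ... | yes refl rewrite δ-same i = trans (cong (_+ 1 * s i) (weigh-δ-≥ i ≤-refl)) (*-identityˡ (s i))
  ... | no  x≢i  rewrite δ-other x≢i = trans (+-identityʳ _) (weigh-δ-< i (≤∧≢⇒< x≤i x≢i))

  -- Double counting: each entry `x` contributes a Kronecker delta to the counts, which picks out
  -- the single weight `s x`.
  weigh-count : ∀ {i xs} → All (_< i) xs → weigh s (λ j → count j xs) i ≡ sum (map s xs)
  weigh-count {i} []                      = weigh-0 i
  weigh-count {i} {x ∷ xs} (x<i ∷ xs<i) =
    trans (weigh-+ (δ x) (λ j → count j xs) i) (cong₂ _+_ (weigh-δ-< i x<i) (weigh-count xs<i))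

sum-ones : ∀ xs → sum (map (const {B = ℕ} 1) xs) ≡ length xs
sum-ones []       = refl
sum-ones (_ ∷ xs) = cong suc (sum-ones xs)

total : (ℕ → ℕ) → ℕ → ℕ
total = weigh (const 1)

total-count : ∀ {i xs} → All (_< i) xs → total (λ j → count j xs) i ≡ length xs
total-count {xs = xs} xs<i = trans (weigh-count (const 1) xs<i) (sum-ones xs)

length-filter-count : ∀ {A : Set} (f : A → ℕ) i xs →
                      length (filter (λ x → f x ≟ i) xs) ≡ count i (map f xs)
length-filter-count f i []       = refl
length-filter-count f i (x ∷ xs) with f x ≡ᵇ i
... | true  = cong suc (length-filter-count f i xs)
... | false = length-filter-count f i xs

lookup-injective : ∀ {A : Set} {xs : List A} → Unique xs → ∀ i j → List.lookup xs i ≡ List.lookup xs j → i ≡ j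
lookup-injective (_  ∷ _) zero    zero    _  = refl
lookup-injective (x≢ ∷ _) zero    (suc j) eq = contradiction eq (All.lookup x≢ (∈-lookup j))
lookup-injective (x≢ ∷ _) (suc i) zero    eq = contradiction (sym eq) (All.lookup x≢ (∈-lookup i))
lookup-injective (_  ∷ u) (suc i) (suc j) eq = cong suc (lookup-injective u i j eq)

-- Pigeonhole principle: sending an entry to its position in `ys` is injective.
length-mono-⊆ : ∀ {A : Set} {xs ys : List A} → Unique xs → xs ⊆ ys → length xs ≤ length ys
length-mono-⊆ {A} {xs} {ys} unique xs⊆ys = Fin.injective⇒≤ {f = position} injective
  where
  position : Fin (length xs) → Fin (length ys)
  position i = Any.index (xs⊆ys (∈-lookup i))

  lookup-position : ∀ i → List.lookup ys (position i) ≡ List.lookup xs i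
  lookup-position i = sym (Any.lookup-index (xs⊆ys (∈-lookup i)))

  injective : ∀ {i j} → position i ≡ position j → i ≡ j
  injective {i} {j} eq = lookup-injective unique i j
    (trans (sym (lookup-position i)) (trans (cong (List.lookup ys) eq) (lookup-position j)))

-- Since `f` may identify entries, the pigeonhole principle is applied to the sublists of entries
-- that `f` sends to `i`.
count-mono-⊆ : ∀ {A : Set} (f : A → ℕ) {xs ys} → Unique xs → xs ⊆ ys →
               ∀ i → count i (map f xs) ≤ count i (map f ys)
count-mono-⊆ f {xs} {ys} unique xs⊆ys i =
  subst₂ _≤_ (length-filter-count f i xs) (length-filter-count f i ys)
    (length-mono-⊆ (Unique.filter⁺ P? unique)
      λ x∈ → let x∈xs , fx≡i = ∈-filter⁻ P? {xs = xs} x∈ in ∈-filter⁺ P? (xs⊆ys x∈xs) fx≡i)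
  where P? = λ x → f x ≟ i

-- Uniqueness of division with remainder: a remainder below `m` cannot make up for a smaller
-- quotient.
digits-unique : ∀ {r r′ m} q q′ → r < m → r′ < m → r + q * m ≡ r′ + q′ * m → q ≡ q′ × r ≡ r′
digits-unique {r} {r′} {m} q q′ r<m r′<m eq with <-cmp q q′
... | tri≈ _ refl _ = refl , +-cancelʳ-≡ _ r r′ eq
... | tri< q<q′ _ _ = contradiction eq (<⇒≢ (<-≤-trans (+-monoˡ-< _ r<m)
                        (≤-trans (*-monoˡ-≤ m q<q′) (m≤n+m _ r′))))
... | tri> _ _ q′<q = contradiction (sym eq) (<⇒≢ (<-≤-trans (+-monoˡ-< _ r′<m)
                        (≤-trans (*-monoˡ-≤ m q′<q) (m≤n+m _ r))))

^-distribʳ-* : ∀ c m n → (m * n) ^ c ≡ m ^ c * n ^ c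
^-distribʳ-* zero    m n = refl
^-distribʳ-* (suc c) m n = trans (cong (m * n *_) (^-distribʳ-* c m n)) (ring m n (m ^ c) (n ^ c))
  where
  ring : ∀ m n p q → m * n * (p * q) ≡ m * p * (n * q)
  ring = solve-∀

-- The decay of (2/3)^k absorbs a linear factor. In the induction step, the slack `k * 2 ^ k`
-- completes the left side to three times that of the hypothesis.
linear-vs-geometric : ∀ k → (k + 2) * 2 ^ k ≤ 3 * 3 ^ k
linear-vs-geometric zero    = s≤s (s≤s z≤n)
linear-vs-geometric (suc k) = begin
  (suc k + 2) * 2 ^ suc k        ≤⟨ m≤m+n _ (k * 2 ^ k) ⟩
  (suc k + 2) * 2 ^ suc k + k * 2 ^ k ≡⟨ ring (2 ^ k) k ⟩
  3 * ((k + 2) * 2 ^ k)          ≤⟨ *-monoʳ-≤ 3 (linear-vs-geometric k) ⟩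
  3 * (3 * 3 ^ k)                ∎
  where
  open ≤-Reasoning
  ring : ∀ p k → (suc k + 2) * (2 * p) + k * p ≡ 3 * ((k + 2) * p)
  ring = solve-∀

-- Three parts, each larger than n / 3, would add up to more than `n`.
few : ∀ {n B t} → B * suc n ≤ 3 * t → t ≤ n → B ≤ 2
few {n} {B} {t} B-few t≤n with B ≤? 2
... | yes B≤2 = B≤2
... | no  B≰2 = contradiction
  (≤-trans (*-monoˡ-≤ (suc n) (≰⇒> B≰2)) (≤-trans B-few (*-monoʳ-≤ 3 t≤n)))
  (<⇒≱ (*-monoʳ-< 3 (n<1+n n)))

-- For positive `x`, both 3 and `3 * x` are at most `n`. For `x = 0` the claim is `3 ≤ 2 * n`, where
-- `2 ≤ n` enters.
small-factor : ∀ {n x} → 2 ≤ n → 3 * x ≤ n → suc x * 3 ≤ 2 * n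
small-factor {n} {zero}  2≤n _    = ≤-trans (n≤1+n 3) (*-monoʳ-≤ 2 2≤n)
small-factor {n} {suc x} _ 3x≤n = +-mono-≤ {3} {n} (≤-trans (*-monoʳ-≤ 3 {1} (s≤s z≤n)) 3x≤n)
  (≤-trans (≤-reflexive (*-comm (suc x) 3)) (≤-trans 3x≤n (≤-reflexive (sym (+-identityʳ n)))))

big-factor : ∀ {n x} → 2 ≤ n → x ≤ n → suc x ≤ 2 * n
big-factor {n} {x} (s≤s _) x≤n = +-mono-≤ {1} {n} (s≤s z≤n) (≤-trans x≤n (≤-reflexive (sym (+-identityʳ n))))

module Radix (size : ℕ → ℕ) where

  stride : ℕ → ℕ
  stride zero    = 1
  stride (suc i) = stride i * suc (size i)

  stride>0 : ∀ i → 0 < stride i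
  stride>0 zero    = s≤s z≤n
  stride>0 (suc i) = *-mono-< (stride>0 i) (s≤s z≤n)

  value : (ℕ → ℕ) → ℕ → ℕ
  value = weigh stride

  Fits : (ℕ → ℕ) → Set
  Fits d = ∀ i → d i ≤ size i

  -- Position `i` has base `size i + 1`, so that digits up to `size i` cause no carry.
  value<stride : ∀ {d} → Fits d → ∀ i → value d i < stride i
  value<stride fits zero    = s≤s z≤n
  value<stride {d} fits (suc i) = <-≤-trans (+-monoˡ-< _ (value<stride fits i))
    (≤-trans (*-monoˡ-≤ (stride i) (s≤s (fits i))) (≤-reflexive (*-comm (suc (size i)) (stride i))))

  -- The lower digits form a remainder below `stride i`, so `digits-unique` splits off the top
  -- digit.
  value-injective : ∀ {d d′} → Fits d → Fits d′ → ∀ i → value d i ≡ value d′ i → ∀ {j} → j < i → d j ≡ d′ j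
  value-injective {d} {d′} fits fits′ (suc i) eq {j} (s≤s j≤i)
    with q , r ← digits-unique (d i) (d′ i) (value<stride fits i) (value<stride fits′ i) eq
    with j ≟ i
  ... | yes refl = q
  ... | no  j≢i  = value-injective fits fits′ i r (≤∧≢⇒< j≤i j≢i)

  private
    ring₁ : ∀ s x p → s * x * (3 * p) ≡ x * 3 * (s * p)
    ring₁ = solve-∀
    ring₂ : ∀ s x p → s * x * p ≡ x * (s * p)
    ring₂ = solve-∀
    ring₃ : ∀ t x → 3 * (t + x * 1) ≡ 3 * t + 3 * x
    ring₃ = solve-∀

  -- B counts the colors i with 3 * size i > n, and k the others.
  stride-split : ∀ {n} → 2 ≤ n → ∀ c → total size c ≤ n →
    ∃[ k ] ∃[ B ] k + B ≡ c × B * suc n ≤ 3 * total size c × stride c * 3 ^ k ≤ (2 * n) ^ c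
  stride-split 2≤n zero    _     = 0 , 0 , refl , z≤n , s≤s z≤n
  stride-split {n} 2≤n (suc c) total≤n
    with k , B , k+B , B-few , bound ← stride-split 2≤n c (≤-trans (m≤m+n (total size c) _) total≤n)
    with 3 * size c ≤? n
  ... | yes small = suc k , B , cong suc k+B ,
    ≤-trans B-few (*-monoʳ-≤ 3 (m≤m+n (total size c) _)) ,
    ≤-trans (≤-reflexive (ring₁ (stride c) (suc (size c)) (3 ^ k)))
      (*-mono-≤ (small-factor {x = size c} 2≤n small) bound)
  ... | no  big   = k , suc B , trans (+-suc k B) (cong suc k+B) ,
    ≤-trans (+-mono-≤ (≰⇒> big) B-few)
      (≤-reflexive (trans (+-comm (3 * size c) _) (sym (ring₃ (total size c) (size c))))) ,
    ≤-trans (≤-reflexive (ring₂ (stride c) (suc (size c)) (3 ^ k)))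
      (*-mono-≤ (big-factor 2≤n (≤-trans (≤-reflexive (sym (*-identityʳ (size c))))
                                   (≤-trans (m≤n+m _ (total size c)) total≤n))) bound)

  -- At most two of the sizes exceed n / 3; every other factor size i + 1 is at most
  -- 2 n / 3, and the geometric decay absorbs the factor c.
  stride-bound : ∀ {n} → 2 ≤ n → ∀ c → total size c ≤ n → c * stride c ≤ 12 * n ^ c
  stride-bound {n} 2≤n c total≤n
    with k , B , refl , B-few , bound ← stride-split 2≤n c total≤n =
    -- Multiplying by `3 ^ k` first keeps the decay (2/3)^k free of fractions.
    *-cancelʳ-≤ _ _ (3 ^ k) {{m^n≢0 3 k}} (begin
      (k + B) * stride c * 3 ^ k      ≡⟨ *-assoc (k + B) _ _ ⟩
      (k + B) * (stride c * 3 ^ k)    ≤⟨ *-monoʳ-≤ (k + B) bound ⟩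
      (k + B) * (2 * n) ^ c           ≡⟨ cong ((k + B) *_) (^-distribʳ-* c 2 n) ⟩
      (k + B) * (2 ^ c * n ^ c)       ≤⟨ *-mono-≤ (+-monoʳ-≤ k B≤2)
                                           (*-monoˡ-≤ (n ^ c) (^-monoʳ-≤ 2 (+-monoʳ-≤ k B≤2))) ⟩
      (k + 2) * (2 ^ (k + 2) * n ^ c) ≡⟨ cong (λ p → (k + 2) * (p * n ^ c)) (^-distribˡ-+-* 2 k 2) ⟩
      (k + 2) * (2 ^ k * 4 * n ^ c)   ≡⟨ ring₄ (k + 2) (2 ^ k) (n ^ c) ⟩
      (k + 2) * 2 ^ k * (4 * n ^ c)   ≤⟨ *-monoˡ-≤ (4 * n ^ c) (linear-vs-geometric k) ⟩
      -- The 4 is the price `2 ^ 2` of the two large factors, the 3 comes from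
      -- `linear-vs-geometric`; together they give 12.
      3 * 3 ^ k * (4 * n ^ c)         ≡⟨ ring₅ (3 ^ k) (n ^ c) ⟩
      12 * n ^ c * 3 ^ k              ∎)
    where
    open ≤-Reasoning
    B≤2 : B ≤ 2
    B≤2 = few B-few total≤n
    ring₄ : ∀ a p q → a * (p * 4 * q) ≡ a * p * (4 * q)
    ring₄ = solve-∀
    ring₅ : ∀ p q → 3 * p * (4 * q) ≡ 12 * q * p
    ring₅ = solve-∀

-- Input and walks

module _ {A : Set} where

  ‼-++ʳ : ∀ (xs : List A) {ys} i → (xs ++ ys) ‼ (length xs + i) ≡ ys ‼ i
  ‼-++ʳ []       i = refl
  ‼-++ʳ (x ∷ xs) i = ‼-++ʳ xs i

  ‼-++ˡ : ∀ {xs ys : List A} i {x} → xs ‼ i ≡ just x → (xs ++ ys) ‼ i ≡ just x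
  ‼-++ˡ {_ ∷ _}  zero    eq = eq
  ‼-++ˡ {_ ∷ xs} (suc i) eq = ‼-++ˡ {xs} i eq

  ‼-tabulate : ∀ {n} (f : Fin n → A) i → tabulate f ‼ toℕ i ≡ just (f i)
  ‼-tabulate f zero    = refl
  ‼-tabulate f (suc i) = ‼-tabulate (f ∘ suc) i

  ‼-length : ∀ (xs : List A) {i} → length xs ≤ i → xs ‼ i ≡ nothing
  ‼-length []       _         = refl
  ‼-length (_ ∷ xs) (s≤s ≤i) = ‼-length xs ≤i

  triples : ∀ {m} → (f g h : Fin m → A) → List A
  triples f g h = concat (tabulate λ a → f a ∷ g a ∷ h a ∷ [])

  length-triples : ∀ {m} (f g h : Fin m → A) → length (triples f g h) ≡ m * 3
  length-triples {zero}  f g h = refl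
  length-triples {suc m} f g h = cong (_+_ 3) (length-triples (f ∘ suc) (g ∘ suc) (h ∘ suc))

  ‼-triples : ∀ {m} (f g h : Fin m → A) a →
    (triples f g h ‼ (toℕ a * 3) ≡ just (f a)) ×
    (triples f g h ‼ suc (toℕ a * 3) ≡ just (g a)) ×
    (triples f g h ‼ suc (suc (toℕ a * 3)) ≡ just (h a))
  ‼-triples f g h zero    = refl , refl , refl
  ‼-triples f g h (suc a) = ‼-triples (f ∘ suc) (g ∘ suc) (h ∘ suc) a

module Input (x : Instance) where
  open Instance x

  opaque
    -- Opaque, so that the memory is used through the equations below and not through the encoded
    -- list.
    input : ℕ → ℤ
    input = State.mem (initial encode)

  -- Start addresses of the blocks behind the six header cells and the colors; `strides` is the
  -- first cell after the input. The sums are repeated because the program computes them by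
  -- additions.
  arcs lowers uppers strides : ℕ
  arcs    = 6 + n
  lowers  = arcs + m + m + m
  uppers  = lowers + c
  strides = uppers + c

  private
    colorAt : Fin n → ℤ
    colorAt v = + toℕ (χ v)

    tailAt headAt lengthAt : Fin m → ℤ
    tailAt a   = + toℕ (proj₁ (arc a))
    headAt a   = + toℕ (proj₂ (arc a))
    lengthAt a = + w a

    colors triple lower upper : List ℤ
    colors = tabulate colorAt
    triple = triples tailAt headAt lengthAt
    lower  = tabulate α
    upper  = tabulate β

    triple-address : ∀ a → arcs + a + a + a ≡ arcs + a * 3
    triple-address = expand arcs
      where
      expand : ∀ p a → p + a + a + a ≡ p + a * 3
      expand = solve-∀

  opaque
    unfolding input

    private
      -- The six header cells vanish by computation, as `arcs` starts with six successors; the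
      -- colors are skipped by `‼-++ʳ`.
      triple-at : ∀ i {z} → triple ‼ i ≡ just z → input (arcs + i) ≡ z
      triple-at i eq = cong (fromMaybe 0ℤ) (trans
        (cong (λ l → (colors ++ triple ++ lower ++ upper) ‼ (l + i)) (sym (length-tabulate _)))
        (trans (‼-++ʳ colors i) (‼-++ˡ {xs = triple} i eq)))

      after-arcs : ∀ i → input (lowers + i) ≡ fromMaybe 0ℤ ((lower ++ upper) ‼ i)
      after-arcs i = cong (fromMaybe 0ℤ) (trans
        (cong ((colors ++ triple ++ lower ++ upper) ‼_)
          (trans (address n m i) (cong₂ (λ a b → a + (b + i)) (sym (length-tabulate colorAt))
            (sym (length-triples tailAt headAt lengthAt)))))
        (trans (‼-++ʳ colors _) (‼-++ʳ triple i)))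
        where
        address : ∀ n m i → n + m + m + m + i ≡ n + (m * 3 + i)
        address = solve-∀

      after-lower : ∀ i → input (uppers + i) ≡ fromMaybe 0ℤ (upper ‼ i)
      after-lower i = trans (cong input (+-assoc lowers c i)) (trans (after-arcs (c + i))
        (cong (fromMaybe 0ℤ) (trans (cong (λ l → (lower ++ upper) ‼ (l + i)) (sym (length-tabulate α)))
          (‼-++ʳ lower i))))

    initial-input : initial encode ≡ ⟨ 0 , const 0ℤ , input ⟩
    initial-input = refl

    input-n : input 0 ≡ + n
    input-n = refl

    input-m : input 1 ≡ + m
    input-m = refl

    input-c : input 2 ≡ + c
    input-c = refl

    input-s : input 3 ≡ + toℕ s
    input-s = refl

    input-t : input 4 ≡ + toℕ t
    input-t = refl

    input-ℓ : input 5 ≡ ℓ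
    input-ℓ = refl

    input-χ : ∀ v → input (6 + toℕ v) ≡ + toℕ (χ v)
    input-χ v = cong (fromMaybe 0ℤ) (‼-++ˡ {xs = colors} (toℕ v) (‼-tabulate _ v))

    input-tail : ∀ a → input (arcs + toℕ a + toℕ a + toℕ a) ≡ + toℕ (proj₁ (arc a))
    input-tail a = trans (cong input (triple-address (toℕ a))) (triple-at _ (proj₁ (‼-triples _ _ _ a)))

    input-head : ∀ a → input (1 + (arcs + toℕ a + toℕ a + toℕ a)) ≡ + toℕ (proj₂ (arc a))
    input-head a = trans (cong input (trans (cong (_+_ 1) (triple-address (toℕ a))) (sym (+-suc arcs _))))
      (triple-at _ (proj₁ (proj₂ (‼-triples _ _ _ a))))

    input-w : ∀ a → input (2 + (arcs + toℕ a + toℕ a + toℕ a)) ≡ + w a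
    input-w a = trans
      (cong input (trans (cong (_+_ 2) (triple-address (toℕ a)))
        (trans (cong suc (sym (+-suc arcs _))) (sym (+-suc arcs _)))))
      (triple-at _ (proj₂ (proj₂ (‼-triples _ _ _ a))))

    input-α : ∀ i → input (lowers + toℕ i) ≡ α i
    input-α i = trans (after-arcs (toℕ i)) (cong (fromMaybe 0ℤ) (‼-++ˡ {xs = lower} (toℕ i) (‼-tabulate α i)))

    input-β : ∀ i → input (uppers + toℕ i) ≡ β i
    input-β i = trans (after-lower (toℕ i)) (cong (fromMaybe 0ℤ) (‼-tabulate β i))

    -- Supplies the blank table, in which 0 means that no walk has been found.
    input-end : ∀ {i} → strides ≤ i → input i ≡ 0ℤ
    input-end {i} end≤i with j , refl ← m≤n⇒∃[o]m+o≡n end≤i =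
      trans (cong input (+-assoc uppers c j)) (trans (after-lower (c + j))
        (cong (fromMaybe 0ℤ) (‼-length upper (≤-trans (≤-reflexive (length-tabulate β)) (m≤m+n c j)))))

module Walks (x : Instance) where
  open Instance x
  open Input x

  -- Defined on vertex numbers, because the program runs through these; the absolute value only
  -- turns a nonnegative cell into a natural number.
  color : ℕ → ℕ
  color v = ℤ.∣ input (6 + v) ∣

  color-χ : ∀ v → color (toℕ v) ≡ toℕ (χ v)
  color-χ v = cong ℤ.∣_∣ (input-χ v)

  -- `downFrom` matches the order in which `countVertices` visits the vertices.
  size : ℕ → ℕ
  size i = count i (map color (downFrom n))

  open Radix size public

  -- The color classes partition the vertex set. This limits how many of them can be large.
  total-size : total size c ≡ n
  total-size = trans (total-count (All.map⁺ (All.tabulate λ v∈ → color<c (∈-downFrom⁻ v∈))))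
                 (trans (length-map color (downFrom n)) (length-downFrom n))
    where
    color<c : ∀ {v} → v < n → color v < c
    color<c v<n = subst (λ v → color v < c) (toℕ-fromℕ< v<n)
                    (≤-trans (≤-reflexive (cong suc (color-χ (fromℕ< v<n)))) (toℕ<n _))

  colors : ∀ {u v} → Walk u v → List ℕ
  colors P = map (toℕ ∘ χ) (vertices P)

  index : ∀ {u v} → Walk u v → ℕ
  index P = sum (map stride (colors P))

  digits : ∀ {u v} → Walk u v → ℕ → ℕ
  digits P i = count i (colors P)

  colors<c : ∀ {u v} (P : Walk u v) → All (_< c) (colors P)
  colors<c P = All.map⁺ (All.tabulate λ {v} _ → toℕ<n (χ v))

  value-digits : ∀ {u v} (P : Walk u v) → value (digits P) c ≡ index P
  value-digits P = weigh-count stride (colors<c P)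

  total-digits : ∀ {u v} (P : Walk u v) → total (digits P) c ≡ length (vertices P)
  total-digits P = trans (total-count (colors<c P)) (length-map _ (vertices P))

  digits-colorCount : ∀ {u v} (P : Walk u v) i → digits P (toℕ i) ≡ colorCount i P
  digits-colorCount P i = trans (sym (length-filter-count (toℕ ∘ χ) (toℕ i) (vertices P)))
    (cong length (filter-≐ (λ v → toℕ (χ v) ≟ toℕ i) (λ v → χ v Fin.≟ i)
      (toℕ-injective , cong toℕ) (vertices P)))

  -- The vertices of a path are distinct, so those of one color are distinct members of its color
  -- class.
  path-fits : ∀ {u v} (P : Walk u v) → IsPath P → Fits (digits P)
  path-fits P path i = ≤-trans
    (≤-reflexive (cong (count i) (trans (map-cong (sym ∘ color-χ) (vertices P)) (map-∘ (vertices P)))))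
    (count-mono-⊆ color (Unique.map⁺ toℕ-injective path)
      (λ v∈ → let v , _ , eq = ∈-map⁻ toℕ v∈ in subst (_∈ downFrom n) (sym eq) (∈-downFrom⁺ (toℕ<n v))) i)

  walkArcs : ∀ {u v} → Walk u v → List (Fin m)
  walkArcs ε             = []
  walkArcs ((a , _) ◅ P) = a ∷ walkArcs P

  vertices-heads : ∀ {u v} (P : Walk u v) → vertices P ≡ u ∷ map (proj₂ ∘ arc) (walkArcs P)
  vertices-heads ε              = refl
  vertices-heads ((a , eq) ◅ P) = cong (_ ∷_) (trans (vertices-heads P)
    (cong (λ e → proj₂ e ∷ map (proj₂ ∘ arc) (walkArcs P)) (sym eq)))

  -- The vertices after the first are heads of distinct arcs. A bound in terms of `n` would not
  -- suffice for the running time, since there may be far fewer arcs than vertices.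
  length-path : ∀ {u v} (P : Walk u v) → IsPath P → length (vertices P) ≤ suc m
  length-path P path rewrite vertices-heads P with _ ∷ unique ← path =
    s≤s (≤-trans (≤-reflexive (length-map _ (walkArcs P)))
          (≤-trans (length-mono-⊆ (Unique.map⁻ unique) (λ {a} _ → ∈-allFin a))
            (≤-reflexive (length-tabulate {n = m} _))))

  suffix : ∀ {u v x} (P : Walk u v) → IsPath P → x ∈ vertices P →
           ∃[ Q ] IsPath {x} {v} Q × arcLength Q ≤ arcLength P
  suffix ε       path       (here refl) = ε , path , ≤-refl
  suffix P@(_ ◅ _) path     (here refl) = P , path , ≤-refl
  suffix ((a , _) ◅ P) (_ ∷ path) (there x∈) with Q , pathQ , Q≤P ← suffix P path x∈ =
    Q , pathQ , ≤-trans Q≤P (m≤n+m _ (w a))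

  open import Data.List.Membership.DecPropositional (Fin._≟_ {n}) using (_∈?_)

  -- If `u` recurs, one can start at the later occurrence. This drops at least the first arc, and
  -- its length is positive.
  path-or-shortcut : ∀ {u v} (P : Walk u v) →
                     IsPath P ⊎ ∃[ Q ] IsPath {u} {v} Q × arcLength Q < arcLength P
  path-or-shortcut ε = inj₁ ([] ∷ [])
  path-or-shortcut {u} (e@(a , _) ◅ P) with path-or-shortcut P
  ... | inj₁ path with u ∈? vertices P
  ...   | no  u∉ = inj₁ (All.¬Any⇒All¬ _ u∉ ∷ path)
  ...   | yes u∈ with Q , pathQ , Q≤P ← suffix P path u∈ =
    inj₂ (Q , pathQ , +-mono-≤ (w-pos a) Q≤P)
  path-or-shortcut {u} (e@(a , _) ◅ P) | inj₂ (Q , path , Q<P) with u ∈? vertices Q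
  ...   | no  u∉ = inj₂ (e ◅ Q , All.¬Any⇒All¬ _ u∉ ∷ path , +-monoʳ-< (w a) Q<P)
  ...   | yes u∈ with Q′ , path′ , Q′≤Q ← suffix Q path u∈ =
    inj₂ (Q′ , path′ , +-mono-≤ (w-pos a) (≤-trans Q′≤Q (<⇒≤ Q<P)))

  -- A shortcut around a repeated vertex would undercut the distance.
  shortest⇒path : IsDist s t ℓ → (P : Walk s t) → + arcLength P ℤ.≤ ℓ → IsPath P
  shortest⇒path (_ , minimal) P P≤ℓ with path-or-shortcut P
  ... | inj₁ path             = path
  ... | inj₂ (Q , path , Q<P) =
    contradiction (ℤ.≤-trans P≤ℓ (minimal Q path)) (ℤ.<⇒≱ (ℤ.+<+ Q<P))

-- Preparation: the layout and the strides

$zero $one $n $m $c $s $t $χ $arcs $lowers $uppers $strides $table : Fin 22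
$zero    = # 0
$one     = # 1
$n       = # 2
$m       = # 3
$c       = # 4
$s       = # 5
$t       = # 6
$χ       = # 7
$arcs    = # 8
$lowers  = # 9
$uppers  = # 10
$strides = # 11
$table   = # 12

$stride $j $i $x $v $y $z : Fin 22
$stride = # 13
$j      = # 14
$i      = # 15
$x      = # 16
$v      = # 17
$y      = # 18
$z      = # 19

setup countVertices nextStride computeStrides : Cmd 22

setup = block
  ( set $one (+ 1)
  ∷ set $n (+ 0) ∷ load $n $n
  ∷ set $m (+ 1) ∷ load $m $m
  ∷ set $c (+ 2) ∷ load $c $c
  ∷ set $s (+ 3) ∷ load $s $s
  ∷ set $t (+ 4) ∷ load $t $t
  ∷ set $χ (+ 6)
  ∷ add $arcs $χ $n
  ∷ add $lowers $arcs $m ∷ add $lowers $lowers $m ∷ add $lowers $lowers $m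
  ∷ add $uppers $lowers $c
  ∷ add $strides $uppers $c
  -- The strides `S 0` to `S c` occupy c + 1 cells.
  ∷ add $table $strides $c ∷ add $table $table $one
  ∷ [] )

countVertices =
  block (sub $v $v $one ∷ add $y $χ $v ∷ load $y $y ∷ sub $z $y $i ∷ []) ⨾
  -- Equality by two sign tests: neither `y - i` nor `i - y` is positive.
  unless $z (block (sub $z $i $y ∷ []) ⨾ unless $z (block (add $x $x $stride ∷ [])))

nextStride =
  -- Starting from the old stride and adding it once per vertex of color `i` multiplies it by
  -- `size i + 1`.
  block (add $x $zero $stride ∷ add $v $zero $n ∷ []) ⨾
  while $v countVertices ⨾
  block (add $stride $zero $x ∷ add $i $one $i ∷ add $y $strides $i ∷ store $y $stride ∷ sub $j $j $one ∷ [])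

computeStrides =
  -- Strides are stored multiplied by `n`, the row length of the table, so that they serve directly
  -- as address offsets.
  block (add $stride $n $zero ∷ store $strides $stride ∷ add $j $zero $c ∷ set $i (+ 0) ∷ []) ⨾
  while $j nextStride

loopCost-const : ∀ k j → loopCost (const k) j ≡ 2 + j * (2 + k)
loopCost-const k zero    = refl
loopCost-const k (suc j) = trans (cong (_+_ (2 + k)) (loopCost-const k j)) (ring k (j * (2 + k)))
  where
  ring : ∀ k a → 2 + k + (2 + a) ≡ 2 + (2 + k + a)
  ring = solve-∀

+-difference : ∀ a b → + (a + b) ℤ.- + a ≡ + b
+-difference a b = trans (ℤ.m-n≡m⊖n (a + b) a) (trans (ℤ.⊖-≥ (m≤m+n a b)) (cong +_ (m+n∸m≡n a b)))

difference≤0 : ∀ a b → + a ℤ.- + b ℤ.≤ 0ℤ → a ≤ b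
difference≤0 a b = ℤ.drop‿+≤+ ∘ ℤ.i-j≤0⇒i≤j

difference>0 : ∀ a b → 0ℤ ℤ.< + a ℤ.- + b → a ≢ b
difference>0 a b 0<a-b refl = ℤ.<⇒≱ 0<a-b (ℤ.≤-reflexive (ℤ.+-inverseʳ (+ a)))

δ-counted : ∀ x T k y i → y ≡ i → x + T + k * T ≡ x + (δ y i + k) * T
δ-counted x T k y i refl rewrite δ-same y = +-assoc x T (k * T)

δ-skipped : ∀ x T k y i → y ≢ i → x + k * T ≡ x + (δ y i + k) * T
δ-skipped x T k y i y≢i rewrite δ-other y≢i = refl

module Verify (x : Instance) where
  open Instance x
  open Input x
  open Walks x

  table : ℕ
  table = strides + c + 1

  -- The first thirteen registers stay fixed after `setup`; only the other nine vary.
  frame : Vec ℤ 9 → Env 22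
  frame ds = + 0 ∷ + 1 ∷ + n ∷ + m ∷ + c ∷ + toℕ s ∷ + toℕ t ∷ + 6
           ∷ + arcs ∷ + lowers ∷ + uppers ∷ + strides ∷ + table ∷ ds

  record Inputs (M : Mem) : Set where
    field unchanged : ∀ {i} → i < strides → M i ≡ input i

    private
      arcs≤strides : arcs ≤ strides
      arcs≤strides = begin
        arcs          ≤⟨ m≤m+n arcs m ⟩
        arcs + m      ≤⟨ m≤m+n (arcs + m) m ⟩
        arcs + m + m  ≤⟨ m≤m+n (arcs + m + m) m ⟩
        lowers        ≤⟨ m≤m+n lowers c ⟩
        uppers        ≤⟨ m≤m+n uppers c ⟩
        strides       ∎
        where open ≤-Reasoning

      χ-in : ∀ {v} → v < n → 6 + v < strides
      χ-in v<n = <-≤-trans (+-monoʳ-< 6 v<n) arcs≤strides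

      arc-in : ∀ {a} → a < m → 2 + (arcs + a + a + a) < strides
      arc-in {a} a<m = begin-strict
        2 + (arcs + a + a + a)             <⟨ n<1+n _ ⟩
        3 + (arcs + a + a + a)             ≡⟨ ring arcs a ⟩
        arcs + suc a + suc a + suc a       ≤⟨ +-mono-≤ (+-mono-≤ (+-monoʳ-≤ arcs a<m) a<m) a<m ⟩
        lowers                             ≤⟨ m≤m+n _ _ ⟩
        uppers                             ≤⟨ m≤m+n _ _ ⟩
        strides                            ∎
        where
        open ≤-Reasoning
        ring : ∀ p a → 3 + (p + a + a + a) ≡ p + suc a + suc a + suc a
        ring = solve-∀

    load-ℓ : M 5 ≡ ℓ
    load-ℓ = trans (unchanged (≤-trans (m≤m+n 6 n) arcs≤strides)) input-ℓ

    load-color : ∀ {v} → v < n → M (6 + v) ≡ + color v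
    load-color {v} v<n = trans (unchanged (χ-in v<n)) (nonneg v<n)
      where
      nonneg : ∀ {v} → v < n → input (6 + v) ≡ + color v
      nonneg v<n rewrite sym (toℕ-fromℕ< v<n) = trans (input-χ _) (cong +_ (sym (color-χ _)))

    load-χ : ∀ v → M (6 + toℕ v) ≡ + toℕ (χ v)
    load-χ v = trans (unchanged (χ-in (toℕ<n v))) (input-χ v)

    load-tail : ∀ a → M (arcs + toℕ a + toℕ a + toℕ a) ≡ + toℕ (proj₁ (arc a))
    load-tail a = trans (unchanged (<⇒≤ (<⇒≤ (arc-in (toℕ<n a))))) (input-tail a)

    load-head : ∀ a → M (1 + (arcs + toℕ a + toℕ a + toℕ a)) ≡ + toℕ (proj₂ (arc a))
    load-head a = trans (unchanged (<⇒≤ (arc-in (toℕ<n a)))) (input-head a)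

    load-w : ∀ a → M (2 + (arcs + toℕ a + toℕ a + toℕ a)) ≡ + w a
    load-w a = trans (unchanged (arc-in (toℕ<n a))) (input-w a)

    load-α : ∀ i → M (lowers + toℕ i) ≡ α i
    load-α i = trans (unchanged (<-≤-trans (+-monoʳ-< lowers (toℕ<n i)) (m≤m+n uppers c))) (input-α i)

    load-β : ∀ i → M (uppers + toℕ i) ≡ β i
    load-β i = trans (unchanged (+-monoʳ-< uppers (toℕ<n i))) (input-β i)

  open Inputs

  Strides : ℕ → Mem → Set
  Strides h M = ∀ {i} → i ≤ h → M (strides + i) ≡ + (stride i * n)

  Blank : Mem → Set
  Blank M = ∀ {i} → table ≤ i → M i ≡ 0ℤ

  Inputs-store : ∀ {M i z} → strides ≤ i → Inputs M → Inputs (M Defs.[ i ≔ z ])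
  Inputs-store {M} {i} {z} end≤i ok .unchanged j<end =
    trans (update-other M i z (λ { refl → <⇒≱ j<end end≤i })) (unchanged ok j<end)

  -- A family indexed by explicit register vectors: matching on the constructor reveals the register
  -- contents. The other loop invariants follow this pattern.
  data StrideInv (h : ℕ) : Assertion 22 where
    stride-inv : ∀ {i T x v y z a b M} → i + h ≡ c → T ≡ stride i * n →
      Inputs M → Strides i M → Blank M →
      StrideInv h (frame (+ T ∷ + h ∷ + i ∷ x ∷ v ∷ y ∷ z ∷ a ∷ b ∷ [])) M

  module _ {T j i : ℕ} {a b : ℤ} {M : Mem} (ok : Inputs M) where

    -- The invariant fixes the final value: it is the part already in `$x` plus the contributions of
    -- the vertices still to be visited.
    data CountInv (h : ℕ) : Assertion 22 where
      count-inv : ∀ {x y z} → h ≤ n → x + count i (map color (downFrom h)) * T ≡ T * suc (size i) →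
        CountInv h (frame (+ T ∷ + j ∷ + i ∷ + x ∷ + h ∷ y ∷ z ∷ a ∷ b ∷ [])) M

    countVertices-runs : ∀ {h ρ M} → CountInv (suc h) ρ M → Runs countVertices 8 (CountInv h) ρ M
    countVertices-runs {h} (count-inv {x} h<n sum) = run-seq
      (run-block (+ h , refl , + (6 + h) , refl , _ , + color h , refl , load-color ok h<n , _ , refl ,
        run-unless
          (λ color≤i → run-seq (run-block (_ , refl , run-unless
            (λ i≤color → run-block (+ (x + T) , refl , count-inv (<⇒≤ h<n)
              (trans (δ-counted x T _ (color h) i
                (≤-antisym (difference≤0 (color h) i color≤i) (difference≤0 i (color h) i≤color))) sum)))
            (λ i>color → count-inv (<⇒≤ h<n)
              (trans (δ-skipped x T _ (color h) i (difference>0 i (color h) i>color ∘ sym)) sum)))))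
          (λ color>i → count-inv (<⇒≤ h<n)
            (trans (δ-skipped x T _ (color h) i (difference>0 (color h) i color>i)) sum))))

    countVertices-exits : ∀ {ρ M} → CountInv 0 ρ M → lookup ρ $v ℤ.≤ 0ℤ
    countVertices-exits (count-inv _ _) = ℤ.≤-refl

    countVertices-continues : ∀ {h ρ M} → CountInv (suc h) ρ M →
      0ℤ ℤ.< lookup ρ $v × Runs countVertices 8 (CountInv h) ρ M
    countVertices-continues inv@(count-inv _ _) = ℤ.+<+ (s≤s z≤n) , countVertices-runs inv

  nextStride-cost : ℕ
  nextStride-cost = 2 + (loopCost (const 8) n + 5)

  nextStride-runs : ∀ {h ρ M} → StrideInv (suc h) ρ M → Runs nextStride nextStride-cost (StrideInv h) ρ M
  nextStride-runs {h} (stride-inv {i} {T} {a = a} {b} {M} i+h refl ok strides-ok blank) =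
    run-seq (run-block (+ T , refl , + n , refl , run-seq (run-mono ≤-refl finish
      (run-while (CountInv ok) (countVertices-exits ok) (countVertices-continues ok) n
        (count-inv ≤-refl (trans (cong (_+_ T) (*-comm (size i) T)) (sym (*-suc T (size i)))))))))
    where
    instep : suc i + h ≡ c
    instep = trans (sym (+-suc i h)) i+h

    finish : ∀ {ρ M′} → CountInv {T} {suc h} {i} {a} {b} {M} ok 0 ρ M′ → Runs (block _) 5 (StrideInv h) ρ M′
    finish (count-inv {x} _ x≡) = run-block
      (+ x , refl , + suc i , refl , + (strides + suc i) , refl , _ , refl , + h , refl ,
      stride-inv instep
        (trans (trans (sym (+-identityʳ x)) x≡) (swap (stride i) n (suc (size i))))
        (Inputs-store (m≤m+n strides (suc i)) ok) strides-ok′ blank′)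
      where
      M″ = M Defs.[ strides + suc i ≔ + x ]

      swap : ∀ s n t → s * n * t ≡ s * t * n
      swap = solve-∀

      strides-ok′ : Strides (suc i) M″
      strides-ok′ {j} j≤ with j ≟ suc i
      ... | yes refl = trans (update-same M (strides + suc i) (+ x))
        (cong +_ (trans (trans (sym (+-identityʳ x)) x≡) (swap (stride i) n (suc (size i)))))
      ... | no  j≢   = trans (update-other M (strides + suc i) (+ x) (λ eq → j≢ (sym (+-cancelˡ-≡ strides _ _ eq))))
        (strides-ok (s≤s⁻¹ (≤∧≢⇒< j≤ j≢)))

      blank′ : Blank M″
      blank′ {j} table≤j = trans (update-other M (strides + suc i) (+ x)
          (<⇒≢ (<-≤-trans (+-monoʳ-< strides (s≤s (m+n≤o⇒m≤o (suc i) (≤-reflexive instep))))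
            (≤-trans (≤-reflexive (trans (+-suc strides c) (+-comm 1 (strides + c)))) table≤j))))
        (blank table≤j)

  data Prepared : Assertion 22 where
    prepared : ∀ {T j i x v y z a b M} → T ≡ stride c * n →
      Inputs M → Strides c M → Blank M →
      Prepared (frame (+ T ∷ j ∷ i ∷ x ∷ v ∷ y ∷ z ∷ a ∷ b ∷ [])) M

  prepare-cost : ℕ
  prepare-cost = 20 + (4 + loopCost (const nextStride-cost) c)

  prepare-runs : Runs (setup ⨾ computeStrides) prepare-cost Prepared (replicate 22 (+ 0)) input
  prepare-runs = run-seq (run-block
    ( 0 , + n , refl , input-n , 1 , + m , refl , input-m , 2 , + c , refl , input-c
    , 3 , + toℕ s , refl , input-s , 4 , + toℕ t , refl , input-t
    , + arcs , refl , + (arcs + m) , refl , + (arcs + m + m) , refl , + lowers , refl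
    , + uppers , refl , + strides , refl , + (strides + c) , refl , + table , refl
    -- `n + 0` is what `stride 0 * n` computes to, so that the invariant starts with `refl`.
    , run-seq (run-block (+ (n + 0) , refl , strides , refl , + c , refl ,
        run-mono ≤-refl finish (run-while StrideInv
          (λ { (stride-inv _ _ _ _ _) → ℤ.≤-refl })
          (λ { inv@(stride-inv _ _ _ _ _) → ℤ.+<+ (s≤s z≤n) , nextStride-runs inv }) c
          (stride-inv refl refl (Inputs-store ≤-refl (record { unchanged = λ _ → refl }))
            first blank))))))
    where
    finish : ∀ {ρ M} → StrideInv 0 ρ M → Prepared ρ M
    finish (stride-inv {i} i≡ refl ok strides-ok blank) with refl ← trans (sym (+-identityʳ i)) i≡ =
      prepared refl ok strides-ok blank

    first : Strides 0 (input Defs.[ strides ≔ + (n + 0) ])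
    first z≤n = trans (cong (input Defs.[ strides ≔ + (n + 0) ]) (+-identityʳ strides))
                  (update-same input strides (+ (n + 0)))

    blank : Blank (input Defs.[ strides ≔ + (n + 0) ])
    blank {i} table≤i = trans
      (update-other input strides (+ (n + 0))
        (<⇒≢ (<-≤-trans (m<m+n strides {c + 1} (m≤n+m 1 c))
          (≤-trans (≤-reflexive (sym (+-assoc strides c 1))) table≤i))))
      (input-end (≤-trans (≤-trans (m≤m+n strides c) (m≤m+n (strides + c) 1)) table≤i))

-- Search: the table, and the decoding of its hits

-- Registers 13 to 21 are reused.  $rem takes over the value of $stride, which is
-- n * S c after the preparation.
$rem $row $hit $a $p $u $e $w $k : Fin 22
$rem = # 13
$row = # 14
$hit = # 15
$a   = # 16
$p   = # 17
$u   = # 18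
$e   = # 19
$w   = # 20
$k   = # 21

placeTarget relax readDigit rejectDigit decode nextRow search : Cmd 22

placeTarget = block
  ( add $p $χ $t ∷ load $p $p ∷ add $p $strides $p ∷ load $p $p ∷ add $p $table $p ∷ add $p $p $t
  -- The empty walk at `t` has length 0, hence the entry 1 + ℓ.
  ∷ set $a (+ 5) ∷ load $a $a ∷ add $a $one $a ∷ store $p $a
  ∷ add $row $zero $table ∷ set $hit (+ 0) ∷ [] )

relax =
  block
    ( sub $a $a $one ∷ add $p $arcs $a ∷ add $p $p $a ∷ add $p $p $a
    ∷ load $u $p ∷ add $p $one $p ∷ load $e $p ∷ add $p $one $p ∷ load $w $p
    ∷ add $e $row $e ∷ load $e $e ∷ sub $e $e $w
    -- Prepending `u` raises the index by the stride of its color; the stored multiple of `n` is the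
    -- distance to the target row.
    ∷ add $p $χ $u ∷ load $p $p ∷ add $p $strides $p ∷ load $p $p ∷ add $p $row $p ∷ add $p $p $u
    ∷ load $w $p ∷ sub $w $w $e ∷ [] ) ⨾
  -- Larger entries belong to shorter walks, so a candidate replaces an entry that does not exceed
  -- it.
  unless $w (block (store $p $e ∷ []))

readDigit =
  block (sub $a $a $one ∷ add $p $strides $a ∷ load $u $p ∷ set $k (+ 0) ∷ sub $e $e $u ∷ []) ⨾
  while $e (block (add $k $one $k ∷ sub $e $e $u ∷ []))

rejectDigit =
  -- `readDigit` subtracts one stride too many, which the first addition undoes. The one added at
  -- the end makes a positive value mean that the lower bound holds.
  block (add $e $e $u ∷ add $p $lowers $a ∷ load $p $p ∷ sub $p $k $p ∷ add $p $one $p ∷ []) ⨾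
  unless $p (block (set $w (+ 1) ∷ [])) ⨾
  block (add $p $uppers $a ∷ load $p $p ∷ sub $p $p $k ∷ add $p $one $p ∷ []) ⨾
  unless $p (block (set $w (+ 1) ∷ []))

decode =
  -- The offset of row `k` is `k * n`. With the extra one, a positive value after a subtraction
  -- means that a whole stride was contained.
  block (sub $e $row $table ∷ add $e $one $e ∷ set $w (+ 0) ∷ add $a $zero $c ∷ []) ⨾
  while $a (readDigit ⨾ rejectDigit) ⨾
  unless $w (block (set $hit (+ 1) ∷ []))

nextRow =
  block (add $a $zero $m ∷ []) ⨾
  while $a relax ⨾
  -- The difference is positive exactly for an empty entry, that is, if the row has no walk from `s`
  -- of length at most ℓ.
  block (add $p $row $s ∷ load $p $p ∷ sub $p $one $p ∷ []) ⨾
  unless $p decode ⨾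
  block (add $row $row $n ∷ sub $rem $rem $n ∷ [])

search = placeTarget ⨾ while $rem nextRow

module Search (x : Instance) (dist : ℓ-is-distance x) where
  open Instance x
  open Input x
  open Walks x
  open Verify x
  open Inputs

  D : ℕ
  D = arcLength (proj₁ (proj₁ dist))

  ℓ≡D : ℓ ≡ + D
  ℓ≡D = sym (proj₂ (proj₂ (proj₁ dist)))

  cell : ℕ → Fin n → ℕ
  cell k u = table + k * n + toℕ u

  private
    shuffle : ∀ t u a → t + (u + a) ≡ t + a + u
    shuffle = solve-∀

  cell-injective : ∀ {k k′ u u′} → cell k u ≡ cell k′ u′ → k ≡ k′ × u ≡ u′
  cell-injective {k} {k′} {u} {u′} eq
    with q , r ← digits-unique k k′ (toℕ<n u) (toℕ<n u′)
           (+-cancelˡ-≡ table _ _ (trans (shuffle table (toℕ u) (k * n))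
             (trans eq (sym (shuffle table (toℕ u′) (k′ * n))))))
    = q , toℕ-injective r

  table≤cell : ∀ k u → table ≤ cell k u
  table≤cell k u = ≤-trans (m≤m+n table (k * n)) (m≤m+n _ (toℕ u))

  strides<table : strides + c < table
  strides<table = ≤-reflexive (+-comm 1 (strides + c))

  strides≤cell : ∀ k u → strides ≤ cell k u
  strides≤cell k u = ≤-trans (≤-trans (m≤m+n strides c) (<⇒≤ strides<table)) (table≤cell k u)

  -- A cell holds 1 + ℓ minus the length of a shortest walk of its index to t,
  -- truncated at 0: the blank memory then means that there is no such walk.
  Entry : ℕ → Fin n → ℕ → Set
  Entry k u g = g ≡ 0 ⊎ ∃[ P ] index {u} {t} P ≡ k × arcLength P + g ≡ suc D

  Sound : Mem → Set
  Sound M = ∀ k u → ∃[ g ] M (cell k u) ≡ + g × Entry k u g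

  -- The entry is at least 1 + ℓ minus the length of `P`, put additively to avoid truncated
  -- subtraction.
  Covered : Mem → ∀ {u} → Walk u t → Set
  Covered M {u} P = ∃[ g ] M (cell (index P) u) ≡ + g × suc D ≤ arcLength P + g

  -- The first arc of P has been processed once the arcs from a on have been
  -- processed for row k, and all arcs for the rows before k.
  Ready : ℕ → ℕ → ∀ {u} → Walk u t → Set
  Ready k a ε             = ⊤
  Ready k a ((b , _) ◅ P) = index P < k ⊎ (index P ≡ k × a ≤ toℕ b)

  Complete : ℕ → ℕ → Mem → Set
  Complete k a M = ∀ {u} (P : Walk u t) → Ready k a P → Covered M P

  record Good (k a : ℕ) (M : Mem) : Set where
    field
      inputs   : Inputs M
      strided  : Strides c M
      sound    : Sound M
      complete : Complete k a M

  open Good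

  -- Strides are positive, so removing the first arc leads to an earlier row, for which all arcs
  -- have been processed.
  ready : ∀ {k} a {u} (P : Walk u t) → index P ≡ k → Ready k a P
  ready a ε           _    = tt
  ready a {u} (_ ◅ P) refl = inj₁ (+-monoˡ-≤ (index P) (stride>0 (toℕ (χ u))))

  module _ {M k a} (good : Good k (suc a) M) (b : Fin m) (b≡a : toℕ b ≡ a) where

    private
      u v : Fin n
      u = proj₁ (arc b)
      v = proj₂ (arc b)

      k′ : ℕ
      k′ = stride (toℕ (χ u)) + k

    -- Passing from `suc a` to `a` makes only those walks ready that start with `b` and go on with a
    -- walk of index `k`; the latter is covered by the entry `g`.
    complete-step : ∀ M′ {g} → M (cell k v) ≡ + g →
      (∀ {y} (P : Walk y t) → Covered M P → Covered M′ P) →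
      (∃[ o ] M′ (cell k′ u) ≡ + o × g ≤ w b + o) → Complete k a M′
    complete-step _ _ keep _ ε _ = keep ε (complete good ε tt)
    complete-step _ _ keep _ P@(_ ◅ _) (inj₁ <k) = keep P (complete good P (inj₁ <k))
    complete-step M′ {g} Mv keep (o , M′u , g≤) P@((b′ , eq) ◅ P′) (inj₂ (P′≡k , a≤b′)) with suc a ≤? toℕ b′
    ... | yes a<b′ = keep P (complete good P (inj₂ (P′≡k , a<b′)))
    ... | no  a≮b′ with refl ← toℕ-injective (trans b≡a (≤-antisym a≤b′ (≮⇒≥ a≮b′)))
                   with refl ← eq | refl ← P′≡k | g′ , Mv′ , covered ← complete good P′ (ready (suc a) P′ P′≡k)
                   with refl ← ℤ.+-injective (trans (sym Mv) Mv′) =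
      o , M′u , ≤-trans covered (≤-trans (+-monoʳ-≤ (arcLength P′) g≤)
        (≤-reflexive (swap (arcLength P′) (w b) o)))
      where
      swap : ∀ p w o → p + (w + o) ≡ w + p + o
      swap = solve-∀

    relax-skip : ∀ {g o} → M (cell k v) ≡ + g → M (cell k′ u) ≡ + o → g ≤ w b + o → Good k a M
    relax-skip Mv Mu g≤ .inputs   = inputs good
    relax-skip Mv Mu g≤ .strided  = strided good
    relax-skip Mv Mu g≤ .sound    = sound good
    relax-skip Mv Mu g≤ .complete = complete-step M Mv (λ _ covered → covered) (_ , Mu , g≤)

    relax-store : ∀ {g o g′} → M (cell k v) ≡ + g → M (cell k′ u) ≡ + o → w b + g′ ≡ g → o ≤ g′ →
                  Good k a (M Defs.[ cell k′ u ≔ + g′ ])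
    relax-store {g} {o} {g′} Mv Mu w+g′ o≤g′ = record
      { inputs   = Inputs-store (strides≤cell k′ u) (inputs good)
      ; strided  = λ {i} i≤c → trans (update-other M (cell k′ u) (+ g′)
                     (>⇒≢ (≤-<-trans (+-monoʳ-≤ strides i≤c) (<-≤-trans strides<table (table≤cell k′ u)))))
                     (strided good i≤c)
      ; sound    = sound′
      ; complete = complete-step M′ Mv keep (g′ , update-same M (cell k′ u) (+ g′) , ≤-reflexive (sym w+g′))
      }
      where
      M′ = M Defs.[ cell k′ u ≔ + g′ ]

      new : Entry k′ u g′
      new with sound good k v
      ... | g₁ , Mv₁ , entry with refl ← ℤ.+-injective (trans (sym Mv) Mv₁) with entry
      -- An empty entry at the head would force `w b + g′ ≡ 0`, but arc lengths are positive.
      ...   | inj₁ refl = contradiction (≤-trans (w-pos b) (≤-trans (m≤m+n (w b) g′) (≤-reflexive w+g′))) λ ()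
      ...   | inj₂ (P , P≡k , len) = inj₂ ((b , refl) ◅ P , cong (_+_ (stride (toℕ (χ u)))) P≡k ,
        trans (trans (regroup (w b) (arcLength P) g′) (cong (_+_ (arcLength P)) w+g′)) len)
        where
        regroup : ∀ w p g → w + p + g ≡ p + (w + g)
        regroup = solve-∀

      sound′ : Sound M′
      sound′ l y with cell k′ u ≟ cell l y
      ... | no  ≢cell with g₁ , My , entry ← sound good l y =
        g₁ , trans (update-other M (cell k′ u) (+ g′) ≢cell) My , entry
      ... | yes ≡cell with refl , refl ← cell-injective {k′} {l} {u} {y} ≡cell =
        g′ , update-same M (cell k′ u) (+ g′) , new

      keep : ∀ {y} (P : Walk y t) → Covered M P → Covered M′ P
      keep {y} P (g₁ , My , covered) with cell k′ u ≟ cell (index P) y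
      ... | no  ≢cell = g₁ , trans (update-other M (cell k′ u) (+ g′) ≢cell) My , covered
      ... | yes ≡cell = g′ , trans (cong M′ (sym ≡cell)) (update-same M (cell k′ u) (+ g′)) ,
        ≤-trans covered (+-monoʳ-≤ (arcLength P)
          (subst (_≤ g′) (ℤ.+-injective (trans (sym Mu) (trans (cong M ≡cell) My))) o≤g′))

-- Old entries are nonnegative, so a candidate that reaches one is itself a natural number.
relax-taken : ∀ o g w → + o ℤ.- (+ g ℤ.- + w) ℤ.≤ 0ℤ →
              ∃[ g′ ] w + g′ ≡ g × o ≤ g′ × + g ℤ.- + w ≡ + g′
relax-taken o g w ≤0 with w ≤? g
... | yes w≤g with g′ , refl ← m≤n⇒∃[o]m+o≡n w≤g = g′ , refl ,
      ℤ.drop‿+≤+ (subst (+ o ℤ.≤_) (+-difference w g′) (ℤ.i-j≤0⇒i≤j ≤0)) , +-difference w g′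
... | no  w≰g = contradiction (ℤ.drop‿+≤+ (ℤ.0≤i-j⇒j≤i (ℤ.≤-trans (ℤ.+≤+ (z≤n {o})) (ℤ.i-j≤0⇒i≤j ≤0)))) w≰g

relax-not-taken : ∀ o g w → 0ℤ ℤ.< + o ℤ.- (+ g ℤ.- + w) → g ≤ w + o
relax-not-taken o g w 0< with g ≤? w + o
... | yes g≤ = g≤
... | no  g≰ with d , refl ← m≤n⇒∃[o]m+o≡n (<⇒≤ (≰⇒> g≰)) = contradiction
      (ℤ.i≤j⇒i-j≤0 (ℤ.≤-trans (ℤ.+≤+ (m≤m+n o d))
        (ℤ.≤-reflexive (sym (trans (cong (λ g → + g ℤ.- + w) (+-assoc w o d)) (+-difference w (o + d)))))))
      (ℤ.<⇒≱ 0<)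

module Relax (x : Instance) (dist : ℓ-is-distance x) where
  open Instance x
  open Input x
  open Walks x
  open Verify x
  open Inputs
  open Search x dist
  open Good

  module _ (k : ℕ) (rem hit : ℤ) where

    data RelaxInv (a : ℕ) : Assertion 22 where
      relax-inv : ∀ {p u e w z M} → a ≤ m → Good k a M →
        RelaxInv a (frame (rem ∷ + (table + k * n) ∷ hit ∷ + a ∷ p ∷ u ∷ e ∷ w ∷ z ∷ [])) M

    relax-arc : ∀ (b : Fin m) {ρ M} → RelaxInv (suc (toℕ b)) ρ M → Runs relax 22 (RelaxInv (toℕ b)) ρ M
    relax-arc b (relax-inv {M = M} _ good) with good .sound k (proj₂ (arc b))
      | good .sound (stride (toℕ (χ (proj₁ (arc b)))) + k) (proj₁ (arc b))
    ... | g , Mv , _ | o , Mu , _ = run-seq (run-block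
      ( + i , refl , + (arcs + i) , refl , + (arcs + i + i) , refl , + (arcs + i + i + i) , refl
      , arcs + i + i + i , + toℕ u , refl , load-tail ok b
      , + (1 + (arcs + i + i + i)) , refl , 1 + (arcs + i + i + i) , + toℕ v , refl , load-head ok b
      , + (2 + (arcs + i + i + i)) , refl , 2 + (arcs + i + i + i) , + w b , refl , load-w ok b
      , + cell k v , refl , cell k v , + g , refl , Mv
      , + g ℤ.- + w b , refl
      , + (6 + toℕ u) , refl , 6 + toℕ u , + toℕ (χ u) , refl , load-χ ok u
      , + (strides + toℕ (χ u)) , refl
      , strides + toℕ (χ u) , + (stride (toℕ (χ u)) * n) , refl , strided good (<⇒≤ (toℕ<n (χ u)))
      , + (table + k * n + stride (toℕ (χ u)) * n) , refl
      , + cell k′ u , cong +_ (target table k (stride (toℕ (χ u))) n (toℕ u))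
      , cell k′ u , + o , refl , Mu
      , + o ℤ.- (+ g ℤ.- + w b) , refl
      , run-unless
          (λ ≤0 → let g′ , w+g′ , o≤g′ , diff = relax-taken o g (w b) ≤0 in
            run-block (cell k′ u , refl , relax-inv (<⇒≤ (toℕ<n b))
              (subst (λ z → Good k i (M Defs.[ cell k′ u ≔ z ])) (sym diff)
                (relax-store good b refl Mv Mu w+g′ o≤g′))))
          (λ 0< → relax-inv (<⇒≤ (toℕ<n b)) (relax-skip good b refl Mv Mu (relax-not-taken o g (w b) 0<)))))
      where
      i = toℕ b
      u = proj₁ (arc b)
      v = proj₂ (arc b)
      k′ = stride (toℕ (χ u)) + k
      ok = inputs good
      target : ∀ t k s n u → t + k * n + s * n + u ≡ t + (s + k) * n + u
      target = solve-∀

    relax-runs : ∀ {a ρ M} → RelaxInv (suc a) ρ M → 0ℤ ℤ.< lookup ρ $a × Runs relax 22 (RelaxInv a) ρ M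
    relax-runs {ρ = ρ} {M} inv@(relax-inv a<m _) = ℤ.+<+ (s≤s z≤n) ,
      subst (λ a → RelaxInv (suc a) ρ M → Runs relax 22 (RelaxInv a) ρ M) (toℕ-fromℕ< a<m)
        (relax-arc (fromℕ< a<m)) inv

    relax-all : ∀ {ρ M} → RelaxInv m ρ M → Runs (while $a relax) (loopCost (const 22) m) (RelaxInv 0) ρ M
    relax-all = run-while RelaxInv (λ { (relax-inv _ _) → ℤ.≤-refl }) relax-runs m

excess>0 : ∀ i j → 0ℤ ℤ.< + 1 ℤ.+ (i ℤ.- j) → j ℤ.≤ i
excess>0 i j 0< with j ℤ.≤? i
... | yes j≤i = j≤i
... | no  j≰i = contradiction
  (ℤ.≤-trans (ℤ.≤-reflexive (sym (ℤ.+-assoc (+ 1) i (ℤ.- j)))) (ℤ.i≤j⇒i-j≤0 (ℤ.i<j⇒suc[i]≤j (ℤ.≰⇒> j≰i))))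
  (ℤ.<⇒≱ 0<)

excess≤0 : ∀ i j → + 1 ℤ.+ (i ℤ.- j) ℤ.≤ 0ℤ → ¬ j ℤ.≤ i
excess≤0 i j ≤0 j≤i = ℤ.<⇒≱ (ℤ.<-≤-trans (ℤ.+<+ (s≤s z≤n)) (ℤ.+-monoʳ-≤ (+ 1) (ℤ.i≤j⇒0≤j-i j≤i))) ≤0

cancel-difference : ∀ i j → i ℤ.- j ℤ.+ j ≡ i
cancel-difference i j = trans (ℤ.+-assoc i (ℤ.- j) j) (trans (cong (ℤ._+_ i) (ℤ.+-inverseˡ j)) (ℤ.+-identityʳ i))

module Decode (x : Instance) (d : ℕ → ℕ) where
  open Instance x
  open Input x
  open Walks x
  open Verify x
  open Inputs

  InBounds : Fin c → Set
  InBounds i = α i ℤ.≤ + d (toℕ i) × + d (toℕ i) ℤ.≤ β i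

  -- `b` is the rejection flag. The value 0 speaks only of the colors from `j` on, because the most
  -- significant digits are decoded first.
  Verdict : ℕ → ℕ → Set
  Verdict j b = (b ≡ 0 × ∀ i → j ≤ toℕ i → InBounds i) ⊎ (b ≡ 1 × ¬ (∀ i → InBounds i))

  digitCost : ℕ → ℕ
  digitCost j = 5 + loopCost (const 2) (d j) + 13

  module _ (fits : Fits d) {k : ℕ} (value≡k : value d c ≡ k) (rem hit : ℤ)
           {M : Mem} (ok : Inputs M) (strides-ok : Strides c M) where

    locals : (a p u e w k : ℤ) → Env 22
    locals a p u e w q = frame (rem ∷ + (table + k * n) ∷ hit ∷ a ∷ p ∷ u ∷ e ∷ w ∷ q ∷ [])

    data DecodeInv (j : ℕ) : Assertion 22 where
      decode-inv : ∀ {p u e b q} → j ≤ c → e ≡ + suc (value d j * n) → Verdict j b →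
        DecodeInv j (locals (+ j) p u e (+ b) q) M

    module _ (i : Fin c) (b : ℕ) where

      private
        j V T : ℕ
        j = toℕ i
        V = value d j * n
        T = stride j * n

      V<T : V < T
      V<T = *-monoˡ-< n {{>-nonZero (Fin⇒0< s)}} (value<stride fits j)

      -- One stride has been subtracted in advance: with `h` strides left, `$e` is positive exactly
      -- if `h` is, since the lower digits amount to less than one stride.
      data DigitInv (h : ℕ) : Assertion 22 where
        digit-inv : ∀ {p q} → q + h ≡ d j →
          DigitInv h (locals (+ j) p (+ T) (+ (suc V + h * T) ℤ.- + T) (+ b) (+ q)) M

      peel : ∀ h → + (suc V + suc h * T) ℤ.- + T ≡ + (suc V + h * T)
      peel h = trans (cong (λ e → + e ℤ.- + T) (front (suc V) T (h * T))) (+-difference T (suc V + h * T))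
        where
        front : ∀ a b c → a + (b + c) ≡ b + (a + c)
        front = solve-∀

      exhausted : + (suc V + 0 * T) ℤ.- + T ℤ.≤ 0ℤ
      exhausted = ℤ.i≤j⇒i-j≤0 (ℤ.+≤+ (≤-trans (≤-reflexive (+-identityʳ (suc V))) V<T))

      subtract-stride : ∀ {h ρ M′} → DigitInv (suc h) ρ M′ →
        0ℤ ℤ.< lookup ρ $e × Runs (block (add $k $one $k ∷ sub $e $e $u ∷ [])) 2 (DigitInv h) ρ M′
      subtract-stride {h} (digit-inv {q = q} q+h) =
        subst (0ℤ ℤ.<_) (sym (peel h)) (ℤ.+<+ (s≤s z≤n)) ,
        run-block (+ suc q , refl , + (suc V + h * T) ℤ.- + T , cong (ℤ._- + T) (peel h) ,
          digit-inv (trans (sym (+-suc q h)) q+h))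

      restore : + (suc V + 0 * T) ℤ.- + T ℤ.+ + T ≡ + suc V
      restore = trans (cancel-difference _ (+ T)) (cong +_ (+-identityʳ (suc V)))

      Lower : ℕ → Set
      Lower b = (b ≡ 0 × (∀ i′ → j < toℕ i′ → InBounds i′) × α i ℤ.≤ + d j) ⊎ (b ≡ 1 × ¬ (∀ i → InBounds i))

      conclude : ∀ {b} → Lower b → + d j ℤ.≤ β i → Verdict j b
      conclude (inj₂ bad) _ = inj₂ bad
      conclude (inj₁ (refl , above , α≤)) ≤β = inj₁ (refl , λ i′ j≤i′ → here-or-above i′ j≤i′)
        where
        here-or-above : ∀ i′ → j ≤ toℕ i′ → InBounds i′
        here-or-above i′ j≤i′ with j ≟ toℕ i′
        ... | yes j≡i′ with refl ← toℕ-injective j≡i′ = α≤ , ≤β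
        ... | no  j≢i′ = above i′ (≤∧≢⇒< j≤i′ j≢i′)

      check-upper : ∀ {b p} → Lower b →
        Runs (block (add $p $uppers $a ∷ load $p $p ∷ sub $p $p $k ∷ add $p $one $p ∷ []) ⨾
              unless $p (block (set $w (+ 1) ∷ []))) 6 (DecodeInv j)
             (locals (+ j) p (+ T) (+ suc V) (+ b) (+ d j)) M
      check-upper {b} lower = run-seq (run-block
        ( + (uppers + j) , refl , uppers + j , β i , refl , load-β ok i
        , β i ℤ.- + d j , refl , + 1 ℤ.+ (β i ℤ.- + d j) , refl
        , run-unless
            (λ ≤0 → run-block (decode-inv (<⇒≤ (toℕ<n i)) refl
              (inj₂ (refl , λ all → excess≤0 (β i) (+ d j) ≤0 (proj₂ (all i))))))
            (λ 0< → decode-inv (<⇒≤ (toℕ<n i)) refl (conclude lower (excess>0 (β i) (+ d j) 0<)))))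

      rejectDigit-runs : ∀ {ρ M′} → Verdict (suc j) b → DigitInv 0 ρ M′ → Runs rejectDigit 13 (DecodeInv j) ρ M′
      rejectDigit-runs verdict (digit-inv {q = q} q≡) with refl ← trans (sym (+-identityʳ q)) q≡ =
        run-seq (run-block
          ( + suc V , restore , + (lowers + j) , refl , lowers + j , α i , refl , load-α ok i
          , + d j ℤ.- α i , refl , + 1 ℤ.+ (+ d j ℤ.- α i) , refl
          , run-seq (run-unless
              (λ ≤0 → run-block (check-upper (inj₂ (refl , λ all → excess≤0 (+ d j) (α i) ≤0 (proj₁ (all i))))))
              (λ 0< → check-upper (lower verdict (excess>0 (+ d j) (α i) 0<))))))
        where
        lower : Verdict (suc j) b → α i ℤ.≤ + d j → Lower b
        lower (inj₁ (b≡0 , above)) α≤ = inj₁ (b≡0 , above , α≤)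
        lower (inj₂ bad)           α≤ = inj₂ bad

    decode-digit : ∀ (i : Fin c) {ρ M′} → DecodeInv (suc (toℕ i)) ρ M′ →
      Runs (readDigit ⨾ rejectDigit) (digitCost (toℕ i)) (DecodeInv (toℕ i)) ρ M′
    decode-digit i (decode-inv {b = b} _ refl verdict) = run-seq (run-seq (run-block
      ( + j , refl , + (strides + j) , refl , strides + j , + T , refl , strides-ok (<⇒≤ (toℕ<n i))
      , + (suc V + d j * T) ℤ.- + T , cong (λ e → + suc e ℤ.- + T) (split (value d j) (d j) (stride j) n)
      , run-mono ≤-refl (rejectDigit-runs i b verdict)
          (run-while (DigitInv i b) (λ { (digit-inv _) → exhausted i b })
            (subtract-stride i b) (d j) (digit-inv refl)))))
      where
      j = toℕ i
      V = value d j * n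
      T = stride j * n
      split : ∀ v d s n → (v + d * s) * n ≡ v * n + d * (s * n)
      split = solve-∀

    decode-digits : ∀ {ρ M′} → DecodeInv c ρ M′ →
      Runs (while $a (readDigit ⨾ rejectDigit)) (loopCost digitCost c) (DecodeInv 0) ρ M′
    decode-digits = run-while DecodeInv (λ { (decode-inv _ _ _) → ℤ.≤-refl }) iteration c
      where
      iteration : ∀ {j ρ M′} → DecodeInv (suc j) ρ M′ →
        0ℤ ℤ.< lookup ρ $a × Runs (readDigit ⨾ rejectDigit) (digitCost j) (DecodeInv j) ρ M′
      iteration {ρ = ρ} {M′} inv@(decode-inv j<c _ _) = ℤ.+<+ (s≤s z≤n) ,
        subst (λ j → DecodeInv (suc j) ρ M′ → Runs (readDigit ⨾ rejectDigit) (digitCost j) (DecodeInv j) ρ M′)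
          (toℕ-fromℕ< j<c) (decode-digit (fromℕ< j<c)) inv

    data Decoded (h : ℕ) : Assertion 22 where
      accepted : ∀ {a p u e w q} → (∀ i → InBounds i) →
        Decoded h (frame (rem ∷ + (table + k * n) ∷ + 1 ∷ a ∷ p ∷ u ∷ e ∷ w ∷ q ∷ [])) M
      rejected : ∀ {a p u e w q} → ¬ (∀ i → InBounds i) →
        Decoded h (frame (rem ∷ + (table + k * n) ∷ + h ∷ a ∷ p ∷ u ∷ e ∷ w ∷ q ∷ [])) M

  decode-cost : ℕ
  decode-cost = 4 + (loopCost digitCost c + 2)

  decode-runs : (fits : Fits d) {k : ℕ} (value≡k : value d c ≡ k) (rem : ℤ) (h : ℕ)
    {M : Mem} (ok : Inputs M) (strides-ok : Strides c M) → ∀ {a p u e w q} →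
    Runs decode decode-cost (Decoded fits value≡k rem (+ h) ok strides-ok h)
      (frame (rem ∷ + (table + k * n) ∷ + h ∷ a ∷ p ∷ u ∷ e ∷ w ∷ q ∷ [])) M
  decode-runs fits {k} value≡k rem h {M} ok strides-ok = run-seq (run-block
    ( + (k * n) , +-difference table (k * n) , + suc (k * n) , refl , + c , refl
    , run-seq (run-mono ≤-refl finish (decode-digits fits value≡k rem (+ h) ok strides-ok
        (decode-inv ≤-refl (cong (λ v → + suc (v * n)) (sym value≡k))
          (inj₁ (refl , λ i c≤i → contradiction c≤i (<⇒≱ (toℕ<n i)))))))))
    where
    finish : ∀ {ρ M′} → DecodeInv fits value≡k rem (+ h) ok strides-ok 0 ρ M′ →
      Runs (unless $w (block (set $hit (+ 1) ∷ []))) 2 (Decoded fits value≡k rem (+ h) ok strides-ok h) ρ M′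
    finish (decode-inv _ _ (inj₁ (refl , all))) =
      run-unless (λ _ → run-block (accepted λ i → all i z≤n)) (λ { (ℤ.+<+ ()) })
    finish (decode-inv _ _ (inj₂ (refl , bad))) =
      run-unless (λ { (ℤ.+≤+ ()) }) (λ _ → rejected bad)

-- The loop over the rows, and the correctness of the answer.

1-g>0⇒g≡0 : ∀ g → 0ℤ ℤ.< + 1 ℤ.- + g → g ≡ 0
1-g>0⇒g≡0 zero    _  = refl
1-g>0⇒g≡0 (suc g) 0< = contradiction (ℤ.i≤j⇒i-j≤0 (ℤ.+≤+ (s≤s (z≤n {g})))) (ℤ.<⇒≱ 0<)

module Main (x : Instance) (dist : ℓ-is-distance x) where
  open Instance x
  open Input x
  open Walks x
  open Verify x
  open Inputs
  open Search x dist
  open Good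
  open Relax x dist

  Accepts : Walk s t → Set
  Accepts P = IsPath P × + arcLength P ℤ.≤ ℓ
            × (∀ i → α i ℤ.≤ + colorCount i P × + colorCount i P ℤ.≤ β i)

  Flag : ℕ → ℕ → Set
  Flag k f = (f ≡ 1 × IsYes) ⊎ (f ≡ 0 × ∀ P → index P < k → ¬ Accepts P)

  Flag-suc : ∀ {k f} → Flag k f → (∀ P → index P ≡ k → ¬ Accepts P) → Flag (suc k) f
  Flag-suc (inj₁ found) _ = inj₁ found
  Flag-suc {k} (inj₂ (f≡0 , none<k)) none≡k = inj₂ (f≡0 , none≤k)
    where
    none≤k : ∀ P → index P < suc k → ¬ Accepts P
    none≤k P P≤k with m≤n⇒m<n∨m≡n (s≤s⁻¹ P≤k)
    ... | inj₁ P<k = none<k P P<k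
    ... | inj₂ P≡k = none≡k P P≡k

  -- Having processed all arcs for row `k` is the same as having processed none yet for row `suc k`.
  next-row : ∀ {k M} → Good k 0 M → Good (suc k) m M
  next-row {k} {M} good = record
    { inputs = inputs good ; strided = strided good ; sound = sound good ; complete = complete′ }
    where
    complete′ : Complete (suc k) m M
    complete′ ε _ = complete good ε tt
    complete′ P@((b , _) ◅ _) (inj₂ (_ , m≤b)) = contradiction m≤b (<⇒≱ (toℕ<n b))
    complete′ P@(_ ◅ P′) (inj₁ P′≤k) with m≤n⇒m<n∨m≡n (s≤s⁻¹ P′≤k)
    ... | inj₁ P′<k = complete good P (inj₁ P′<k)
    ... | inj₂ P′≡k = complete good P (inj₂ (P′≡k , z≤n))

  index<end : ∀ (P : Walk s t) → IsPath P → index P < stride c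
  index<end P path = subst (_< stride c) (value-digits P) (value<stride (path-fits P path) c)

  -- Mixed-radix digits are unique, so one path speaks for all paths of its row.
  same-digits : ∀ (P Q : Walk s t) → IsPath P → IsPath Q → index P ≡ index Q →
                ∀ i → colorCount i P ≡ digits Q (toℕ i)
  same-digits P Q pathP pathQ P≡Q i = trans (sym (digits-colorCount P i))
    (value-injective (path-fits P pathP) (path-fits Q pathQ) c
      (trans (value-digits P) (trans P≡Q (sym (value-digits Q)))) (toℕ<n i))

  data RowInv (h : ℕ) : Assertion 22 where
    row-inv : ∀ {k R r f a p u e w q M} → k + h ≡ stride c → R ≡ h * n → r ≡ table + k * n →
      Good k m M → Flag k f →
      RowInv h (frame (+ R ∷ + r ∷ + f ∷ a ∷ p ∷ u ∷ e ∷ w ∷ q ∷ [])) M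

  placeTarget-runs : ∀ {ρ M} → Prepared ρ M → Runs placeTarget 12 (RowInv (stride c)) ρ M
  placeTarget-runs (prepared {M = M} refl ok strides-ok blank) = run-block
    ( + (6 + toℕ t) , refl , 6 + toℕ t , + toℕ (χ t) , refl , load-χ ok t
    , + (strides + toℕ (χ t)) , refl
    , strides + toℕ (χ t) , + (S * n) , refl , strides-ok (<⇒≤ (toℕ<n (χ t)))
    , + (table + S * n) , refl , + cell S t , refl
    , 5 , + D , refl , trans (load-ℓ ok) ℓ≡D
    , + suc D , refl , cell S t , refl , + table , refl
    , row-inv refl refl (sym (+-identityʳ table)) good (inj₂ (refl , λ _ ())) )
    where
    S = stride (toℕ (χ t))
    M′ = M Defs.[ cell S t ≔ + suc D ]

    sound′ : Sound M′
    sound′ k u with cell S t ≟ cell k u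
    ... | no  ≢cell = 0 , trans (update-other M (cell S t) (+ suc D) ≢cell) (blank (table≤cell k u)) , inj₁ refl
    ... | yes ≡cell with refl , refl ← cell-injective {S} {k} {t} {u} ≡cell =
      suc D , update-same M (cell S t) (+ suc D) , inj₂ (ε , +-identityʳ S , refl)

    complete′ : Complete 0 m M′
    complete′ ε _ = suc D ,
      trans (cong (λ k → M′ (cell k t)) (+-identityʳ S)) (update-same M (cell S t) (+ suc D)) , ≤-refl
    complete′ ((b , _) ◅ _) (inj₂ (_ , m≤b)) = contradiction m≤b (<⇒≱ (toℕ<n b))

    good : Good 0 m M′
    good = record
      { inputs   = Inputs-store (strides≤cell S t) ok
      ; strided  = λ {i} i≤c → trans (update-other M (cell S t) (+ suc D)
                     (>⇒≢ (≤-<-trans (+-monoʳ-≤ strides i≤c) (<-≤-trans strides<table (table≤cell S t)))))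
                     (strides-ok i≤c)
      ; sound    = sound′
      ; complete = complete′
      }

  -- The cost of `decode` depends on the path found; `decodeBound` is uniform, because the digits of
  -- a path add up to at most m + 1.
  decodeBound rowCost : ℕ
  decodeBound = 12 + (22 * c + 4 * m)
  rowCost     = 1 + (loopCost (const 22) m + (3 + (suc decodeBound + 2)))

  -- A color costs 22 steps, and each unit of its digit one subtraction round of 4 steps.
  loopCost-digits : ∀ d i → loopCost (Decode.digitCost x d) i ≡ 2 + (22 * i + 4 * total d i)
  loopCost-digits d zero    = refl
  loopCost-digits d (suc i) = trans
    (cong₂ (λ a b → 2 + (5 + a + 13) + b) (loopCost-const 2 (d i)) (loopCost-digits d i))
    (ring (d i) i (total d i))
    where
    ring : ∀ x i t → 2 + (5 + (2 + x * 4) + 13) + (2 + (22 * i + 4 * t))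
                   ≡ 2 + (22 * suc i + 4 * (t + x * 1))
    ring = solve-∀

  decode-cost≤ : ∀ (P : Walk s t) → IsPath P → Decode.decode-cost x (digits P) ≤ decodeBound
  decode-cost≤ P path = begin
    4 + (loopCost (Decode.digitCost x (digits P)) c + 2) ≡⟨ cong (λ a → 4 + (a + 2)) (loopCost-digits (digits P) c) ⟩
    4 + (2 + (22 * c + 4 * total (digits P) c) + 2)
      ≤⟨ +-monoʳ-≤ 4 (+-monoˡ-≤ 2 (+-monoʳ-≤ 2 (+-monoʳ-≤ (22 * c) (*-monoʳ-≤ 4
           (≤-trans (≤-reflexive (total-digits P)) (length-path P path)))))) ⟩
    4 + (2 + (22 * c + 4 * suc m) + 2)                   ≡⟨ ring c m ⟩
    decodeBound                                          ∎
    where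
    open ≤-Reasoning
    ring : ∀ c m → 4 + (2 + (22 * c + 4 * suc m) + 2) ≡ 12 + (22 * c + 4 * m)
    ring = solve-∀

  advance-runs : ∀ {k h f a p u e w q M} → k + suc h ≡ stride c → Good k 0 M → Flag (suc k) f →
    Runs (block (add $row $row $n ∷ sub $rem $rem $n ∷ [])) 2 (RowInv h)
      (frame (+ (suc h * n) ∷ + (table + k * n) ∷ + f ∷ a ∷ p ∷ u ∷ e ∷ w ∷ q ∷ [])) M
  advance-runs {k} {h} k+h good flag = run-block
    ( + (table + k * n + n) , refl , + (h * n) , +-difference n (h * n)
    , row-inv (trans (sym (+-suc k h)) k+h) refl (below table (k * n) n) (next-row good) flag )
    where
    below : ∀ t a n → t + a + n ≡ t + (n + a)
    below = solve-∀

  test-runs : ∀ {k h f} → k + suc h ≡ stride c → Flag k f → ∀ {ρ M} →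
    RelaxInv k (+ (suc h * n)) (+ f) 0 ρ M →
    Runs (block (add $p $row $s ∷ load $p $p ∷ sub $p $one $p ∷ []) ⨾ unless $p decode ⨾
          block (add $row $row $n ∷ sub $rem $rem $n ∷ []))
         (3 + (suc decodeBound + 2)) (RowInv h) ρ M
  test-runs {k} {h} {f} k+h flag (relax-inv {u = u} {e} {w} {q} {M} _ good) with sound good k s
  ... | g , Ms , entry = run-seq (run-block
    ( + cell k s , refl , cell k s , + g , refl , Ms , + 1 ℤ.- + g , refl
    , run-seq (run-unless (λ ≤0 → decoded (difference≤0 1 g ≤0) entry)
        (λ 0< → advance-runs k+h good (Flag-suc flag (missed 0<)))) ))
    where
    -- By completeness, an empty entry forces every walk of this row to be longer than ℓ.
    missed : 0ℤ ℤ.< + 1 ℤ.- + g → ∀ P → index P ≡ k → ¬ Accepts P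
    missed 0< P refl (_ , P≤ℓ , _) with g′ , Ms′ , covered ← complete good P (ready 0 P refl)
      with refl ← ℤ.+-injective (trans (sym Ms) Ms′) =
      <⇒≱ (≤-trans covered (≤-reflexive (trans
            (cong (_+_ (arcLength P)) (1-g>0⇒g≡0 g 0<)) (+-identityʳ (arcLength P)))))
        (ℤ.drop‿+≤+ (subst (+ arcLength P ℤ.≤_) ℓ≡D P≤ℓ))

    decoded : ∀ {p} → 1 ≤ g → Entry k s g →
      Runs decode decodeBound (Runs (block (add $row $row $n ∷ sub $rem $rem $n ∷ [])) 2 (RowInv h))
        (frame (+ (suc h * n) ∷ + (table + k * n) ∷ + f ∷ + 0 ∷ p ∷ u ∷ e ∷ w ∷ q ∷ [])) M
    decoded 1≤g (inj₁ refl) = contradiction 1≤g λ ()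
    -- A positive entry comes from a walk of length at most ℓ, which is a path by the promise, so
    -- its digits fit.
    decoded 1≤g (inj₂ (P , refl , len)) =
      run-mono (decode-cost≤ P path) advance
        (decode-runs (path-fits P path) (value-digits P) (+ (suc h * n)) f (inputs good) (strided good))
      where
      open Decode x (digits P)

      P≤ℓ : + arcLength P ℤ.≤ ℓ
      P≤ℓ = subst (+ arcLength P ℤ.≤_) (sym ℓ≡D) (ℤ.+≤+ (s≤s⁻¹
        (≤-trans (≤-reflexive (+-comm 1 (arcLength P)))
          (≤-trans (+-monoʳ-≤ (arcLength P) 1≤g) (≤-reflexive len)))))

      path : IsPath P
      path = shortest⇒path dist P P≤ℓ

      advance : ∀ {ρ M′} →
        Decoded (path-fits P path) (value-digits P) (+ (suc h * n)) (+ f) (inputs good) (strided good) f ρ M′ →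
        Runs (block (add $row $row $n ∷ sub $rem $rem $n ∷ [])) 2 (RowInv h) ρ M′
      advance (accepted all) = advance-runs k+h good (inj₁ (refl , P , path , P≤ℓ ,
        λ i → subst (λ x → α i ℤ.≤ + x × + x ℤ.≤ β i) (digits-colorCount P i) (all i)))
      -- An accepted path `Q` of the same index would have the color counts of `P`, which violate
      -- the bounds.
      advance (rejected bad) = advance-runs k+h good (Flag-suc flag λ { Q Q≡k (pathQ , _ , bounds) →
        bad λ i → subst (λ x → α i ℤ.≤ + x × + x ℤ.≤ β i) (same-digits Q P pathQ path Q≡k i) (bounds i) })

  nextRow-runs : ∀ {h ρ M} → RowInv (suc h) ρ M → 0ℤ ℤ.< lookup ρ $rem × Runs nextRow rowCost (RowInv h) ρ M
  nextRow-runs {h} (row-inv {k} {f = f} k+h refl refl good flag) =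
    ℤ.+<+ (≤-trans (Fin⇒0< s) (m≤m+n n (h * n))) ,
    run-seq (run-block (+ m , refl ,
      run-seq (run-mono ≤-refl (test-runs k+h flag)
        (relax-all k (+ (suc h * n)) (+ f) (relax-inv ≤-refl good)))))

  search-cost : ℕ
  search-cost = 12 + loopCost (const rowCost) (stride c)

  search-runs : ∀ {ρ M} → Prepared ρ M → Runs search search-cost (RowInv 0) ρ M
  search-runs prep = run-seq (run-mono ≤-refl
    (run-while RowInv (λ { (row-inv _ refl _ _ _) → ℤ.≤-refl }) nextRow-runs (stride c))
    (placeTarget-runs prep))

  solve-runs : Runs ((setup ⨾ computeStrides) ⨾ search) (prepare-cost + search-cost) (RowInv 0)
                 (replicate 22 0ℤ) input
  solve-runs = run-seq (run-mono ≤-refl search-runs prepare-runs)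

  reflects : ∀ {ρ M b} → RowInv 0 ρ M → Reflects (0ℤ ℤ.< lookup ρ $hit) b → Reflects IsYes b
  reflects (row-inv _ _ _ _ (inj₁ (refl , found))) (ofʸ _) = ofʸ found
  reflects (row-inv _ _ _ _ (inj₁ (refl , _))) (ofⁿ 0≮1) = contradiction (ℤ.+<+ (s≤s z≤n)) 0≮1
  reflects (row-inv _ _ _ _ (inj₂ (refl , _)))    (ofʸ (ℤ.+<+ ()))
  -- Here `k` equals `stride c`, which exceeds the index of every path.
  reflects (row-inv {k} k≡ _ _ _ (inj₂ (refl , none))) (ofⁿ _) = ofⁿ λ { (P , accepts@(path , _)) →
    none P (<-≤-trans (index<end P path) (≤-reflexive (trans (sym k≡) (+-identityʳ k)))) accepts }

-- The running time.

suc≤^ : ∀ {n} → 2 ≤ n → ∀ c → suc c ≤ n ^ c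
suc≤^ 2≤n zero    = ≤-refl
suc≤^ {n} 2≤n (suc c) = begin
  2 + c             ≤⟨ m≤m+n (2 + c) c ⟩
  2 + c + c         ≡⟨ double c ⟩
  2 * suc c         ≤⟨ *-mono-≤ 2≤n (suc≤^ 2≤n c) ⟩
  n ^ suc c         ∎
  where
  open ≤-Reasoning
  double : ∀ c → 2 + c + c ≡ 2 * suc c
  double = solve-∀

module Cost (x : Instance) (dist : ℓ-is-distance x) (nonDegenerate : NonDegenerate x) where
  open Instance x
  open Walks x
  open Verify x
  open Main x dist

  private
    X N : ℕ
    X = n ^ c * m
    N = stride c

    2≤n : 2 ≤ n
    2≤n = proj₁ nonDegenerate

    n^c≤X : n ^ c ≤ X
    n^c≤X = ≤-trans (≤-reflexive (sym (*-identityʳ (n ^ c)))) (*-monoʳ-≤ (n ^ c) (proj₂ nonDegenerate))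

    0<c : 0 < c
    0<c = Fin⇒0< (χ s)

    -- One factor `n` is set aside; `suc≤^` bounds the number of colors by the remaining power.
    c*n≤n^c : ∀ {c} → 0 < c → c * n ≤ n ^ c
    c*n≤n^c {suc c} _ = ≤-trans (≤-reflexive (*-comm (suc c) n)) (*-monoʳ-≤ n (suc≤^ 2≤n c))

    c*n≤X : c * n ≤ X
    c*n≤X = ≤-trans (c*n≤n^c 0<c) n^c≤X

    c≤X : c ≤ X
    c≤X = ≤-trans (m≤m*n c n {{>-nonZero (≤-trans (s≤s z≤n) 2≤n)}}) c*n≤X

    c*N≤n^c : c * N ≤ 12 * n ^ c
    c*N≤n^c = stride-bound 2≤n c (≤-reflexive total-size)

    N≤n^c : N ≤ 12 * n ^ c
    N≤n^c = ≤-trans (m≤n*m N c {{>-nonZero 0<c}}) c*N≤n^c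

    N*m≤X : N * m ≤ 12 * X
    N*m≤X = ≤-trans (*-monoˡ-≤ m N≤n^c) (≤-reflexive (*-assoc 12 (n ^ c) m))

  -- The summand 2 pays for the last jump and the answer. The monomials are afterwards bounded one
  -- by one.
  cost-expanded : prepare-cost + search-cost + 2
                ≡ 42 + (11 * c + 10 * (c * n)) + (23 * N + 28 * (N * m) + 22 * (c * N))
  cost-expanded = trans
    (cong₂ (λ a b → 20 + (4 + a) + (12 + b) + 2)
      (trans (loopCost-const nextStride-cost c) (cong (λ a → 2 + c * (2 + (2 + (a + 5)))) (loopCost-const 8 n)))
      (trans (loopCost-const rowCost N)
        (cong (λ a → 2 + N * (2 + (1 + (a + (3 + (suc decodeBound + 2)))))) (loopCost-const 22 m))))
    (ring n m c N)
    where
    ring : ∀ n m c N →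
      20 + (4 + (2 + c * (2 + (2 + (2 + n * 10 + 5)))))
      + (12 + (2 + N * (2 + (1 + (2 + m * 24 + (3 + (suc (12 + (22 * c + 4 * m)) + 2))))))) + 2
      ≡ 42 + (11 * c + 10 * (c * n)) + (23 * N + 28 * (N * m) + 22 * (c * N))
    ring = solve-∀

  cost-bound : prepare-cost + search-cost + 2 ≤ 939 * X
  cost-bound = begin
    prepare-cost + search-cost + 2 ≡⟨ cost-expanded ⟩
    42 + (11 * c + 10 * (c * n)) + (23 * N + 28 * (N * m) + 22 * (c * N))
      ≤⟨ +-mono-≤
           (+-mono-≤ (*-monoʳ-≤ 42 (≤-trans 0<c c≤X)) (+-mono-≤ (*-monoʳ-≤ 11 c≤X) (*-monoʳ-≤ 10 c*n≤X)))
           (+-mono-≤ (+-mono-≤ (*-monoʳ-≤ 23 (≤-trans N≤n^c (*-monoʳ-≤ 12 n^c≤X))) (*-monoʳ-≤ 28 N*m≤X))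
             (*-monoʳ-≤ 22 (≤-trans c*N≤n^c (*-monoʳ-≤ 12 n^c≤X)))) ⟩
    -- The factors 12 stem from `stride-bound`, and 63 + 12 * 73 = 939.
    42 * X + (11 * X + 10 * X) + (23 * (12 * X) + 28 * (12 * X) + 22 * (12 * X)) ≡⟨ collect X ⟩
    939 * X ∎
    where
    open ≤-Reasoning
    collect : ∀ X → 42 * X + (11 * X + 10 * X) + (23 * (12 * X) + 28 * (12 * X) + 22 * (12 * X)) ≡ 939 * X
    collect = solve-∀

decider-correct : ∀ {p} x (dist : ℓ-is-distance x) →
  Runs p (Verify.prepare-cost x + Main.search-cost x dist) (Main.RowInv x dist 0)
    (replicate 22 0ℤ) (Input.input x) →
  ∃[ b ] ∃[ k ] decider p $hit ⊢ initial (Instance.encode x) ⇓⟨ k ⟩ b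
    × Reflects (Instance.IsYes x) b
    × (NonDegenerate x → k ≤ 939 * (Instance.n x ^ Instance.c x * Instance.m x))
decider-correct {p} x dist run with decider-halts {x = $hit} run
... | b , k , ρ , M , halts , k≤ , row , reflected =
  b , k , subst (λ σ → decider p $hit ⊢ σ ⇓⟨ k ⟩ b) (sym (Input.initial-input x)) halts ,
  Main.reflects x dist row reflected ,
  λ nonDegenerate → ≤-trans k≤ (Cost.cost-bound x dist nonDegenerate)

theorem4 : SolvableInTimeO Instance.encode Instance.IsYes ℓ-is-distance NonDegenerate (λ x → Instance.n x ^ Instance.c x * Instance.m x)
theorem4 = decider ((setup ⨾ computeStrides) ⨾ search) $hit , 939 ,
  λ x dist → decider-correct x dist (Main.solve-runs x dist)
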